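{- There is no edge-transitive Woolly Hat graph. That is, for every integer $n\ge 3$ and all $a,b,c,d\in\mathbb{Z}_n$ for which $\mathrm{WH}_n(a,b,c,d)$ is defined, the automorphism group of $\mathrm{WH}_n(a,b,c,d)$ does not act transitively on its edge set.
   Context: For an integer $n\ge 3$ and $a,b,c,d\in\mathbb{Z}_n$ with $2a\neq 0$, $b,c,d$ pairwise distinct, and such that no prime divides $n$ together with (integer representatives of) all of $a,b,c,d$, the Woolly Hat graph $\mathrm{WH}_n(a,b,c,d)$ is the graph with vertex set $\{A_i,B_i,C_i : i\in\mathbb{Z}_n\}$ (of order $3n$) with adjacencies, for each $i\in\mathbb{Z}_n$ (subscripts mod $n$): $A_i\sim A_{i-a},A_{i+a},B_i,C_i$; $B_i\sim A_i,C_{i+b},C_{i+c},C_{i+d}$; $C_i\sim A_i,B_{i-b},B_{i-c},B_{i-d}$. Such a graph is connected and $4$-valent. A graph is edge-transitive if its automorphism group acts transitively on its edges. -}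

module Defs where

open import Data.Nat using (ℕ; zero; suc; _≤_)
open import Data.Nat.DivMod using (_mod_)
open import Data.Nat.Divisibility using (_∣_)
open import Data.Nat.Primality using (Prime)
open import Data.Fin using (Fin; toℕ)
open import Data.Product using (Σ; _×_; _,_)
open import Data.Sum using (_⊎_)
open import Relation.Nullary using (¬_)
open import Relation.Binary.PropositionalEquality using (_≡_; _≢_)
open import Function.Bundles using (_↔_; _⇔_; Inverse)

_⊕_ : {n : ℕ} → Fin n → Fin n → Fin n
_⊕_ {suc m} i j = (toℕ i Data.Nat.+ toℕ j) mod suc m

data Vtx (n : ℕ) : Set where
  A B C : Fin n → Vtx n

-- Generating (directed) adjacencies of WH_n(a,b,c,d):
--   A_i ~ A_{i+a},  A_i ~ B_i,  A_i ~ C_i,  B_i ~ C_{i+b}, C_{i+c}, C_{i+d}.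
-- The remaining listed adjacencies (A_i ~ A_{i-a}, C_i ~ B_{i-x}, …) are
-- exactly the reverses of these, obtained by symmetric closure below.
data Gen {n : ℕ} (a b c d : Fin n) : Vtx n → Vtx n → Set where
  AA  : ∀ i → Gen a b c d (A i) (A (i ⊕ a))
  AB  : ∀ i → Gen a b c d (A i) (B i)
  AC  : ∀ i → Gen a b c d (A i) (C i)
  BCb : ∀ i → Gen a b c d (B i) (C (i ⊕ b))
  BCc : ∀ i → Gen a b c d (B i) (C (i ⊕ c))
  BCd : ∀ i → Gen a b c d (B i) (C (i ⊕ d))

WHAdj : {n : ℕ} (a b c d : Fin n) → Vtx n → Vtx n → Set
WHAdj a b c d u v = Gen a b c d u v ⊎ Gen a b c d v u

WHDefined : (n : ℕ) (a b c d : Fin n) → Set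
WHDefined n a b c d =
  3 ≤ n
  × toℕ (a ⊕ a) ≢ 0
  × b ≢ c × b ≢ d × c ≢ d
  × (∀ p → Prime p → p ∣ n → p ∣ toℕ a → p ∣ toℕ b → p ∣ toℕ c → ¬ (p ∣ toℕ d))

record Automorphism {V : Set} (Adj : V → V → Set) : Set where
  field
    perm     : V ↔ V
    preserve : ∀ u v → Adj u v ⇔ Adj (Inverse.to perm u) (Inverse.to perm v)

EdgeTransitive : {V : Set} (Adj : V → V → Set) → Set
EdgeTransitive {V} Adj =
  ∀ u v x y → Adj u v → Adj x y →
    Σ (Automorphism Adj) λ σ →
      let f = Inverse.to (Automorphism.perm σ) in
      (f u ≡ x × f v ≡ y) ⊎ (f u ≡ y × f v ≡ x)

{-# OPTIONS --safe #-}

-- If the automorphism group is transitive on edges, then for every k the number of non-backtracking walks of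
-- length k joining the two ends of an edge is the same for all edges.  Such a number is Σ m_φ [n ∣ φ(a,b,c,d)] for
-- an explicit list of integral linear forms φ (the voltages of the closed walks in the quotient by ℤ_n), so
-- everything depends only on which forms vanish modulo n.  One splits into cases according to this.  A case is
-- contradictory when a form known not to vanish lies in the span of the vanishing ones, or when some integral
-- combination of edge counts with total weight zero is positive: the multiplicities of the vanishing forms add up
-- to a positive number and no undecided form has a negative multiplicity.  Cyclicity of ℤ_n enters through its having
-- at most one involution.  Walks of length k ≤ 5 and k = 7 suffice.  Changing the sign of a and permuting b, c, d do
-- not change the graph, so once a form is excluded for all parameters its whole orbit is excluded.  The tree of
-- cases was found by computer search.
module Submission where

open import Defs
open import Data.Nat using (ℕ)
open import Data.Fin using (Fin)
open import Relation.Nullary using (¬_)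
open import Data.Bool using (Bool; true; false; if_then_else_; _∧_; _∨_; T)
open import Data.Bool.ListAction using (all)
open import Data.Bool.Properties using (T-∧; T-∨; T-≡)
open import Data.Empty using (⊥-elim)
open import Data.Fin using (zero; suc; toℕ; fromℕ<)
import Data.Fin as Fin
open import Data.Fin.Properties using (toℕ-fromℕ<; toℕ-injective; toℕ<n)
open import Data.Integer hiding (suc; ∣_∣; NonZero; _⊔_)
import Data.Integer as ℤ
open import Data.Integer.DivMod using (n%ℕd<d; a≡a%ℕn+[a/ℕn]*n)
open import Data.Integer.Divisibility.Signed
open import Data.Integer.Properties
open import Data.Integer.Tactic.RingSolver using (solve-∀)
open import Data.List using (List; []; _∷_; _++_; map; foldr)
open import Data.List.Membership.Propositional using (_∈_; find)
open import Data.List.Membership.Propositional.Properties using (∈-map⁺; ∈-map⁻)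
open import Data.List.Membership.Propositional.Properties.WithK using (unique∧set⇒bag)
open import Data.List.Properties using (map-∘; map-cong; map-id)
open import Data.List.Relation.Binary.BagAndSetEquality using (∼bag⇒↭)
open import Data.List.Relation.Binary.Permutation.Propositional
  using (_↭_; ↭-refl; ↭-reflexive; ↭-trans; prep; swap)
import Data.List.Relation.Binary.Permutation.Propositional as Perm
open import Data.List.Relation.Binary.Permutation.Propositional.Properties using (∈-resp-↭; map⁺)
open import Data.List.Relation.Unary.All as All using (All; []; _∷_)
import Data.List.Relation.Unary.All.Properties as All
open import Data.List.Relation.Unary.AllPairs using ([]; _∷_)
open import Data.List.Relation.Unary.Any using (Any; here; there; any?)
open import Data.List.Relation.Unary.Unique.Propositional using (Unique)
import Data.List.Relation.Unary.Unique.Propositional.Properties as Unique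
open import Data.Nat using (zero; suc; NonZero; s≤s)
import Data.Nat as ℕ
import Data.Nat.Divisibility as ℕ
import Data.Nat.Properties as ℕ
open import Data.Product using (_×_; _,_; proj₁; proj₂; ∃; map₂)
open import Data.Sum using (_⊎_; inj₁; inj₂)
open import Data.Unit using (⊤; tt)
open import Data.Vec using (Vec; []; _∷_; zipWith; replicate; lookup)
import Data.Vec as Vec
open import Data.Vec.Properties using (≡-dec; lookup∘tabulate; lookup-map; lookup-replicate)
open import Function using (_∘_; id; mk⇔; Equivalence; Inverse; Injective)
open import Relation.Binary using (DecidableEquality)
open import Relation.Binary.PropositionalEquality
open import Relation.Nullary using (Dec; yes; no; does)
open import Relation.Nullary.Decidable using (toSum; map′; _×-dec_)

-- Linear forms and tables of multiplicities

Form : ℕ → Set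
Form = Vec ℤ

infixl 6 _⊕ᶠ_
infix 4 _≟ᶠ_ _<ᶠ_

_⊕ᶠ_ : ∀ {d} → Form d → Form d → Form d
_⊕ᶠ_ = zipWith _+_

⊝_ : ∀ {d} → Form d → Form d
⊝_ = Vec.map (-_)

_⊛_ : ∀ {d} → ℤ → Form d → Form d
m ⊛ φ = Vec.map (m *_) φ

𝟎 : ∀ {d} → Form d
𝟎 = replicate _ 0ℤ

_≟ᶠ_ : ∀ {d} (φ ψ : Form d) → Dec (φ ≡ ψ)
_≟ᶠ_ = ≡-dec _≟_

_<ᶠ_ : ∀ {d} → Form d → Form d → Bool
[]      <ᶠ []      = false
(x ∷ φ) <ᶠ (y ∷ ψ) = if x ≤ᵇ y then (if y ≤ᵇ x then φ <ᶠ ψ else true) else false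

-- A row (φ , m) stands for m·[n ∣ φ(a,b,c,d)]; sums are well defined on any tables, but merge equal forms only
-- when the rows are sorted.
Table : Set
Table = List (Form 4 × ℤ)

consRow : Form 4 → ℤ → Table → Table
consRow φ m T = if does (m ≟ 0ℤ) then T else (φ , m) ∷ T

infixr 5 _⊹_
_⊹_ : Table → Table → Table
[]            ⊹ S             = S
R@(_ ∷ _)     ⊹ []            = R
R@((φ , m) ∷ T) ⊹ S@((ψ , l) ∷ U) =
  if does (φ ≟ᶠ ψ) then consRow φ (m + l) (T ⊹ U)
  else if φ <ᶠ ψ then (φ , m) ∷ (T ⊹ S)
  else (ψ , l) ∷ (R ⊹ U)

transform : (Form 4 → Form 4) → ℤ → Table → Table
transform h c = map (λ { (φ , m) → h φ , c * m })

pairUp : List Table → List Table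
pairUp (T ∷ U ∷ Ts) = (T ⊹ U) ∷ pairUp Ts
pairUp Ts           = Ts

total : ℕ → List Table → Table
-- Tables still unmerged when the fuel ends are folded in, so the sum is right for any fuel.
total zero       Ts = foldr _⊹_ [] Ts
total (suc fuel) Ts = total fuel (pairUp Ts)

-- Pairwise merging, so that 12 rounds sort any table of at most 2¹² rows.
collect : (Form 4 → Form 4) → Table → Table
collect h T = total 12 (map (λ { (φ , m) → (h φ , m) ∷ [] }) T)

-- Symbolic walk counts

Part : Set
Part = Fin 3

pattern 𝔸 = zero
pattern 𝔹 = suc zero
pattern ℂ = suc (suc zero)

-- A dart (t , v) at the part s joins the vertex of s with index i to the vertex of t with index i + v(a,b,c,d).
Dart : Set
Dart = Part × Form 4

a⁺ b⁺ c⁺ d⁺ : Form 4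
a⁺ = 1ℤ ∷ 0ℤ ∷ 0ℤ ∷ 0ℤ ∷ []
b⁺ = 0ℤ ∷ 1ℤ ∷ 0ℤ ∷ 0ℤ ∷ []
c⁺ = 0ℤ ∷ 0ℤ ∷ 1ℤ ∷ 0ℤ ∷ []
d⁺ = 0ℤ ∷ 0ℤ ∷ 0ℤ ∷ 1ℤ ∷ []

darts : Part → List Dart
darts 𝔸 = (𝔸 , a⁺) ∷ (𝔸 , ⊝ a⁺) ∷ (𝔹 , 𝟎) ∷ (ℂ , 𝟎) ∷ []
darts 𝔹 = (𝔸 , 𝟎) ∷ (ℂ , b⁺) ∷ (ℂ , c⁺) ∷ (ℂ , d⁺) ∷ []
darts ℂ = (𝔸 , 𝟎) ∷ (𝔹 , ⊝ b⁺) ∷ (𝔹 , ⊝ c⁺) ∷ (𝔹 , ⊝ d⁺) ∷ []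

-- For fixed k, the walks of length k from each part to each part.
Level : Set
Level = Vec (Vec Table 3) 3

_!_ : Level → Part × Part → Table
G ! (s , t) = Vec.lookup (Vec.lookup G s) t

tabulate₂ : (Part → Part → Table) → Level
tabulate₂ f = Vec.tabulate (λ s → Vec.tabulate (f s))

-- Non-backtracking walks of a 4-regular graph with adjacency operator 𝒜 obey f₂ = 𝒜 f₁ − 4 f₀ and
-- f_{k+2} = 𝒜 f_{k+1} − 3 f_k for k ≥ 1.
backtracks : ℕ → ℤ
backtracks zero    = + 4
backtracks (suc _) = + 3

stationary : Part → Part → Table
stationary s t = if does (s Fin.≟ t) then (𝟎 , 1ℤ) ∷ [] else []

level₀ : Level
level₀ = tabulate₂ stationary

extend : Level → Part → Part → Table
extend G s t = foldr (λ { (s′ , v) → transform (v ⊕ᶠ_) 1ℤ (G ! (s′ , t)) ⊹_ }) [] (darts s)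

level₁ : Level
level₁ = tabulate₂ (extend level₀)

recur : ℕ → Level → Level → Part → Part → Table
recur k G H s t = extend H s t ⊹ transform (λ φ → φ) (- backtracks k) (G ! (s , t))

next : ℕ → Level → Level → Level
next k G H = tabulate₂ (recur k G H)

Edge : Set
Edge = Part × Dart

-- One representative of each class of edges under translation by ℤ_n.
edges : Vec Edge 6
edges = (𝔸 , 𝔸 , a⁺) ∷ (𝔸 , 𝔹 , 𝟎) ∷ (𝔸 , ℂ , 𝟎) ∷ (𝔹 , ℂ , b⁺) ∷ (𝔹 , ℂ , c⁺) ∷ (𝔹 , ℂ , d⁺) ∷ []

-- n divides φ(a,b,c,d) exactly when it divides -φ(a,b,c,d), so the two forms can share a row.
upToSign : Form 4 → Form 4
upToSign φ = if φ <ᶠ (⊝ φ) then ⊝ φ else φ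

-- Both directions are counted, since an automorphism may reverse an edge.
edgeTable : Level → Edge → Table
edgeTable G (s , t , v) =
  collect upToSign
    (transform (⊝ v ⊕ᶠ_) 1ℤ (G ! (s , t)) ++ transform (v ⊕ᶠ_) 1ℤ (G ! (t , s)))

Profile : Set
Profile = Vec Table 6

-- The recurrence has order two, hence two consecutive levels, of lengths k and k + 1, are carried
-- along.
profiles : ℕ → ℕ → Level → Level → List Profile
profiles zero    k G H = []
profiles (suc j) k G H = Vec.map (edgeTable G) edges ∷ profiles j (suc k) H (next k G H)

-- Case trees and their checker

-- Generators, in echelon form, of the lattice of forms known to vanish; a zero row means that there is no pivot.
data Echelon : ℕ → Set where
  []  : Echelon 0
  _∷_ : ∀ {d} → Form (suc d) → Echelon d → Echelon (suc d)

empty : ∀ {d} → Echelon d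
empty {zero}  = []
empty {suc d} = 𝟎 ∷ empty

quot : ℤ → ℤ → ℤ
-- With this value a zero row eliminates nothing.
quot x (+ zero)      = 0ℤ
quot x p@(+ (suc _)) = x / p
quot x p@(-[1+ _ ])  = x / p

eliminate : ∀ {d} → Form (suc d) → Form (suc d) → Form (suc d)
eliminate r@(p ∷ _) v@(x ∷ _) = (- quot x p) ⊛ r ⊕ᶠ v

-- Remainders are canonical, so for rows in echelon form two forms that differ by an element of the
-- lattice reduce to the same form. Soundness uses only that the reduced form differs from the given
-- one by such an element.
reduce : ∀ {d} → Echelon d → Form d → Form d
reduce []      v = v
reduce (r ∷ E) v with eliminate r v
... | x ∷ w = x ∷ reduce E w

euclid : ∀ {d} → ℕ → Form (suc d) → Form (suc d) → Form (suc d) × Form (suc d)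
euclid zero       r v = r , v
euclid (suc fuel) r v@(x ∷ _) = if does (x ≟ 0ℤ) then r , v else euclid fuel v (eliminate v r)

-- Soundness does not depend on the fuel: a vector whose leading entry has not been cleared is dropped.
insert : ∀ {d} → Form d → Echelon d → Echelon d
insert v []      = []
insert v (r ∷ E) with euclid 20 r v
... | s , x ∷ w = s ∷ (if does (x ≟ 0ℤ) then insert w E else E)

normalize : Echelon 4 → Form 4 → Form 4
normalize E φ = pick (reduce E φ) (reduce E (⊝ φ))
  where
  pick : Form 4 → Form 4 → Form 4
  pick φ ψ = if φ <ᶠ ψ then ψ else φ

data Certificate : Set where
  -- some form known not to vanish is in the lattice of vanishing forms
  close   : Certificate
  -- the combination of the walk counts of length k at the six edges with the given weights is positive
  weigh   : (k : ℕ) → Vec ℤ 6 → Certificate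
  -- 2φ and 2ψ vanish, hence φ, ψ or φ − ψ does
  torsion : (φ ψ : Form 4) → (c₁ c₂ c₃ : Certificate) → Certificate
  split   : (φ : Form 4) → (c₁ c₂ : Certificate) → Certificate

nth : List Profile → ℕ → Profile
-- Empty tables have value 0 at all six edges, so a length out of range is balanced trivially.
nth []       k       = replicate _ []
nth (P ∷ Ps) zero    = P
nth (P ∷ Ps) (suc k) = nth Ps k

scale : ℤ → Table → Table
scale c T = if does (c ≟ 0ℤ) then [] else transform (λ φ → φ) c T

combine : ∀ {m} → Vec ℤ m → Vec Table m → Table
combine []       []       = []
combine (c ∷ cs) (T ∷ Ts) = scale c T ++ combine cs Ts

sumℤ : ∀ {m} → Vec ℤ m → ℤ
sumℤ []       = 0ℤ
sumℤ (c ∷ cs) = c + sumℤ cs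

constant : Table → ℤ
constant []            = 0ℤ
constant ((φ , m) ∷ T) = if does (φ ≟ᶠ 𝟎) then m + constant T else constant T

-- Either the row is already counted by `constant`, or its term is nonnegative: the multiplicity is
-- nonnegative, or the indicator is 0.
harmless : List (Form 4) → Form 4 × ℤ → Bool
harmless Z (φ , m) = does (φ ≟ᶠ 𝟎) ∨ does (0ℤ ≤? m) ∨ does (any? (φ ≟ᶠ_) Z)

outweighs : List (Form 4) → Table → Bool
outweighs Z T = does (0ℤ <? constant T) ∧ all (harmless Z) T

-- E generates forms that vanish; Z lists forms that do not.
check : List Profile → Echelon 4 → List (Form 4) → Certificate → Bool
check Ps E Z close = does (any? (λ ψ → reduce E ψ ≟ᶠ 𝟎) Z)
check Ps E Z (weigh k cs) =
  does (sumℤ cs ≟ 0ℤ)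
  -- `Z` is normalized as well, so that membership is tested between representatives.
  ∧ outweighs (map (normalize E) Z) (collect (normalize E) (combine cs (nth Ps k)))
check Ps E Z (torsion φ ψ c₁ c₂ c₃) =
  does (reduce E (φ ⊕ᶠ φ) ≟ᶠ 𝟎) ∧ does (reduce E (ψ ⊕ᶠ ψ) ≟ᶠ 𝟎)
  ∧ check Ps (insert φ E) Z c₁ ∧ check Ps (insert ψ E) Z c₂ ∧ check Ps (insert (φ ⊕ᶠ ⊝ ψ) E) Z c₃
check Ps E Z (split φ c₁ c₂) = check Ps (insert φ E) Z c₁ ∧ check Ps E (φ ∷ Z) c₂

neg₁ swap₂ swap₃ : Form 4 → Form 4
neg₁  (p ∷ q ∷ r ∷ s ∷ []) = - p ∷ q ∷ r ∷ s ∷ []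
swap₂ (p ∷ q ∷ r ∷ s ∷ []) = p ∷ r ∷ q ∷ s ∷ []
swap₃ (p ∷ q ∷ r ∷ s ∷ []) = p ∷ q ∷ s ∷ r ∷ []

closeUnder : (Form 4 → Form 4) → List (Form 4) → List (Form 4)
closeUnder σ Z = Z ++ map σ Z

-- Swap₂ swap₃ swap₂ is a reduced word of the longest element of S₃, so its subwords yield all six
-- permutations of b, c, d.
orbit : Form 4 → List (Form 4)
orbit φ = closeUnder swap₂ (closeUnder swap₃ (closeUnder swap₂ (closeUnder neg₁ (φ ∷ []))))

-- A form that vanishes for no admissible parameters, given that the orbits of the earlier ones do not.
Layer : Set
Layer = Form 4 × Certificate

refute : List Profile → List (Form 4) → List Layer → Certificate → Bool
refute Ps Z []             c = check Ps empty Z c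
refute Ps Z ((φ , c′) ∷ L) c = check Ps (insert φ empty) Z c′ ∧ refute Ps (orbit φ ++ Z) L c

seeds : List (Form 4)
seeds = a⁺ ⊕ᶠ a⁺ ∷ b⁺ ⊕ᶠ ⊝ c⁺ ∷ b⁺ ⊕ᶠ ⊝ d⁺ ∷ c⁺ ⊕ᶠ ⊝ d⁺ ∷ []

-- Soundness of the checker

infix 8 _·_

+-congˡ : ∀ x {y z} → y ≡ z → x + y ≡ x + z
+-congˡ x = cong (λ t → x + t)

_·_ : ∀ {d} → Form d → Vec ℤ d → ℤ
[]      · []      = 0ℤ
(x ∷ φ) · (y ∷ ρ) = x * y + φ · ρ

·-+ : ∀ {d} (φ ψ : Form d) ρ → (φ ⊕ᶠ ψ) · ρ ≡ φ · ρ + ψ · ρ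
·-+ []      []      []      = refl
·-+ (x ∷ φ) (y ∷ ψ) (r ∷ ρ) = trans (+-congˡ ((x + y) * r) (·-+ φ ψ ρ)) (lemma x y r _ _)
  where
  lemma : ∀ x y r p q → (x + y) * r + (p + q) ≡ (x * r + p) + (y * r + q)
  lemma = solve-∀

·-* : ∀ {d} c (φ : Form d) ρ → (c ⊛ φ) · ρ ≡ c * (φ · ρ)
·-* c []      []      = sym (*-zeroʳ c)
·-* c (x ∷ φ) (r ∷ ρ) = trans (+-congˡ (c * x * r) (·-* c φ ρ)) (lemma c x r _)
  where
  lemma : ∀ c x r p → c * x * r + c * p ≡ c * (x * r + p)
  lemma = solve-∀

·-neg : ∀ {d} (φ : Form d) ρ → (⊝ φ) · ρ ≡ - (φ · ρ)
·-neg []      []      = refl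
·-neg (x ∷ φ) (r ∷ ρ) = trans (+-congˡ (- x * r) (·-neg φ ρ)) (lemma x r _)
  where
  lemma : ∀ x r p → - x * r + - p ≡ - (x * r + p)
  lemma = solve-∀

·-𝟎 : ∀ {d} (ρ : Vec ℤ d) → 𝟎 · ρ ≡ 0ℤ
·-𝟎 []      = refl
·-𝟎 (r ∷ ρ) = trans (+-identityˡ _) (·-𝟎 ρ)

T-does : ∀ {A : Set} {a? : Dec A} → T (does a?) → A
T-does {a? = yes a} _ = a

T-× : ∀ {x y} → T (x ∧ y) → T x × T y
T-× = Equivalence.to T-∧

val : (Form 4 → ℤ) → Table → ℤ
val f []            = 0ℤ
val f ((φ , m) ∷ T) = m * f φ + val f T

module _ (f : Form 4 → ℤ) where
  val-consRow : ∀ φ m T → val f (consRow φ m T) ≡ m * f φ + val f T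
  val-consRow φ m T with m ≟ 0ℤ
  ... | yes refl = sym (+-identityˡ _)
  ... | no  _    = refl

  val-if : ∀ b {S T x} → val f S ≡ x → val f T ≡ x → val f (if b then S else T) ≡ x
  val-if true  p q = p
  val-if false p q = q

  val-if-does : ∀ {P : Set} (p? : Dec P) {S T x} →
                (P → val f S ≡ x) → val f T ≡ x → val f (if does p? then S else T) ≡ x
  val-if-does (yes p) s t = s p
  val-if-does (no _)  s t = t

  val-⊹ : ∀ T S → val f (T ⊹ S) ≡ val f T + val f S
  val-⊹ []      S = sym (+-identityˡ _)
  val-⊹ (_ ∷ _) [] = sym (+-identityʳ _)
  val-⊹ R@((φ , m) ∷ T) S@((ψ , l) ∷ U) =
    val-if-does (φ ≟ᶠ ψ)
      (λ { refl → trans (val-consRow φ (m + l) (T ⊹ U))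
                    (trans (+-congˡ ((m + l) * f φ) (val-⊹ T U)) (merged m l (f φ) (val f T) (val f U))) })
      (val-if (φ <ᶠ ψ)
        (trans (+-congˡ (m * f φ) (val-⊹ T S)) (sym (+-assoc (m * f φ) _ _)))
        (trans (+-congˡ (l * f ψ) (val-⊹ R U)) (moved (l * f ψ) (m * f φ + val f T) (val f U))))
    where
    merged : ∀ m l x p q → (m + l) * x + (p + q) ≡ (m * x + p) + (l * x + q)
    merged = solve-∀
    moved : ∀ x y z → x + (y + z) ≡ y + (x + z)
    moved = solve-∀

  val-++ : ∀ T S → val f (T ++ S) ≡ val f T + val f S
  val-++ []            S = sym (+-identityˡ _)
  val-++ ((φ , m) ∷ T) S = trans (+-congˡ (m * f φ) (val-++ T S)) (sym (+-assoc (m * f φ) _ _))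

  val-transform : ∀ h c T → val f (transform h c T) ≡ c * val (f ∘ h) T
  val-transform h c []            = sym (*-zeroʳ c)
  val-transform h c ((φ , m) ∷ T) =
    trans (+-congˡ (c * m * f (h φ)) (val-transform h c T)) (lemma c m _ _)
    where
    lemma : ∀ c m x p → c * m * x + c * p ≡ c * (m * x + p)
    lemma = solve-∀

  vals : List Table → ℤ
  vals []       = 0ℤ
  vals (T ∷ Ts) = val f T + vals Ts

  vals-pairUp : ∀ Ts → vals (pairUp Ts) ≡ vals Ts
  vals-pairUp []           = refl
  vals-pairUp (T ∷ [])     = refl
  vals-pairUp (T ∷ U ∷ Ts) =
    trans (cong₂ _+_ (val-⊹ T U) (vals-pairUp Ts)) (+-assoc (val f T) _ _)

  val-total : ∀ j Ts → val f (total j Ts) ≡ vals Ts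
  val-total zero    []       = refl
  val-total zero    (T ∷ Ts) = trans (val-⊹ T _) (+-congˡ (val f T) (val-total zero Ts))
  val-total (suc j) Ts       = trans (val-total j (pairUp Ts)) (vals-pairUp Ts)

  val-collect : ∀ h → (∀ φ → f (h φ) ≡ f φ) → ∀ T → val f (collect h T) ≡ val f T
  val-collect h eq T = trans (val-total 12 (map _ T)) (go T)
    where
    go : ∀ T → vals (map (λ { (φ , m) → (h φ , m) ∷ [] }) T) ≡ val f T
    go []            = refl
    go ((φ , m) ∷ T) = cong₂ _+_ (trans (+-identityʳ _) (cong (m *_) (eq φ))) (go T)

val-cong : ∀ {f g} → (∀ φ → f φ ≡ g φ) → ∀ T → val f T ≡ val g T
val-cong eq []            = refl
val-cong eq ((φ , m) ∷ T) = cong₂ _+_ (cong (m *_) (eq φ)) (val-cong eq T)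

val-scale : ∀ f c T → val f (scale c T) ≡ c * val f T
val-scale f c T with c ≟ 0ℤ
... | yes refl = refl
... | no  _    = val-transform f id c T

indicator : ∀ {A : Set} → Dec A → ℤ
indicator (yes _) = 1ℤ
indicator (no  _) = 0ℤ

indicator-yes : ∀ {A : Set} (a? : Dec A) → A → indicator a? ≡ 1ℤ
indicator-yes (yes _) _ = refl
indicator-yes (no ¬a) a = ⊥-elim (¬a a)

indicator-no : ∀ {A : Set} (a? : Dec A) → ¬ A → indicator a? ≡ 0ℤ
indicator-no (yes a) ¬a = ⊥-elim (¬a a)
indicator-no (no _)  _  = refl

-- Congruences modulo N and soundness of certificates

module Modular (N : ℤ) where

  χ : ℤ → ℤ
  χ x = indicator (N ∣? x)

  χ-yes : ∀ {x} → N ∣ x → χ x ≡ 1ℤ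
  χ-yes {x} p = indicator-yes (N ∣? x) p

  χ-no : ∀ {x} → ¬ N ∣ x → χ x ≡ 0ℤ
  χ-no {x} p = indicator-no (N ∣? x) p

  χ-⇔ : ∀ {x y} → (N ∣ x → N ∣ y) → (N ∣ y → N ∣ x) → χ x ≡ χ y
  χ-⇔ {x} {y} to from with toSum (N ∣? x)
  ... | inj₁ p  = trans (χ-yes p) (sym (χ-yes (to p)))
  ... | inj₂ ¬p = trans (χ-no ¬p) (sym (χ-no (¬p ∘ from)))

  ∣-≡ : ∀ {x y} → x ≡ y → N ∣ x → N ∣ y
  ∣-≡ = subst (N ∣_)

  infix 4 _≈_
  record _≈_ (x y : ℤ) : Set where
    constructor congruent
    field difference : N ∣ x - y

  ≈-reflexive : ∀ {x y} → x ≡ y → x ≈ y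
  ≈-reflexive {x} refl = congruent (∣-≡ (sym (+-inverseʳ x)) (divides 0ℤ refl))

  ≈-sym : ∀ {x y} → x ≈ y → y ≈ x
  ≈-sym {x} {y} (congruent p) = congruent (∣-≡ (lemma x y) (∣m⇒∣-m p))
    where
    lemma : ∀ x y → - (x - y) ≡ y - x
    lemma = solve-∀

  ≈-trans : ∀ {x y z} → x ≈ y → y ≈ z → x ≈ z
  ≈-trans {x} {y} {z} (congruent p) (congruent q) = congruent (∣-≡ (lemma x y z) (∣m∣n⇒∣m+n p q))
    where
    lemma : ∀ x y z → (x - y) + (y - z) ≡ x - z
    lemma = solve-∀

  ≈-∣ : ∀ {x y} → x ≈ y → N ∣ y → N ∣ x
  ≈-∣ {x} {y} (congruent p) q = ∣-≡ (lemma x y) (∣m∣n⇒∣m+n p q)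
    where
    lemma : ∀ x y → (x - y) + y ≡ x
    lemma = solve-∀

  χ-cong : ∀ {x y} → x ≈ y → χ x ≡ χ y
  χ-cong p = χ-⇔ (≈-∣ (≈-sym p)) (≈-∣ p)

  χ-neg : ∀ x → χ (- x) ≡ χ x
  χ-neg x = χ-⇔ (λ p → ∣-≡ (neg-involutive x) (∣m⇒∣-m p)) ∣m⇒∣-m

  Valid : ∀ {d} → Echelon d → Vec ℤ d → Set
  Valid []      []        = ⊤
  Valid (r ∷ E) (x ∷ ρ) = N ∣ r · (x ∷ ρ) × Valid E ρ

  valid-empty : ∀ {d} (ρ : Vec ℤ d) → Valid empty ρ
  valid-empty []      = tt
  valid-empty (x ∷ ρ) = ∣-≡ (sym (·-𝟎 (x ∷ ρ))) (divides 0ℤ refl) , valid-empty ρ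

  -- A multiple of `r` is subtracted; the argument works for any value of `quot`.
  eliminate-≈ : ∀ {d} (r v : Form (suc d)) ρ → N ∣ r · ρ → v · ρ ≈ eliminate r v · ρ
  eliminate-≈ (p ∷ r) (x ∷ v) ρ N∣r =
    congruent (∣-≡ (trans (lemma q _ ((x ∷ v) · ρ)) (cong (λ t → (x ∷ v) · ρ - t) (sym eq))) (∣n⇒∣m*n q N∣r))
    where
    q = quot x p
    eq : eliminate (p ∷ r) (x ∷ v) · ρ ≡ - q * ((p ∷ r) · ρ) + (x ∷ v) · ρ
    eq = trans (·-+ ((- q) ⊛ (p ∷ r)) (x ∷ v) ρ) (cong (_+ (x ∷ v) · ρ) (·-* (- q) (p ∷ r) ρ))
    lemma : ∀ q r v → q * r ≡ v - (- q * r + v)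
    lemma = solve-∀

  reduce-≈ : ∀ {d} (E : Echelon d) v ρ → Valid E ρ → v · ρ ≈ reduce E v · ρ
  reduce-≈ []      []  []      _         = ≈-reflexive refl
  reduce-≈ (r ∷ E) v   (y ∷ ρ) (N∣r , V) with eliminate r v | eliminate-≈ r v (y ∷ ρ) N∣r
  ... | x ∷ w | p = ≈-trans p (congruent (∣-≡ (lemma (x * y) (w · ρ) _) (_≈_.difference (reduce-≈ E w ρ V))))
    where
    lemma : ∀ z p q → p - q ≡ (z + p) - (z + q)
    lemma = solve-∀

  euclid-∣ : ∀ {d} fuel (r v : Form (suc d)) ρ → N ∣ r · ρ → N ∣ v · ρ →
             N ∣ proj₁ (euclid fuel r v) · ρ × N ∣ proj₂ (euclid fuel r v) · ρ
  euclid-∣ zero       r v ρ p q = p , q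
  euclid-∣ (suc fuel) r v@(x ∷ _) ρ p q with does (x ≟ 0ℤ)
  ... | true  = p , q
  ... | false = euclid-∣ fuel v (eliminate v r) ρ q (≈-∣ (≈-sym (eliminate-≈ v r ρ q)) p)

  insert-valid : ∀ {d} (v : Form d) E ρ → N ∣ v · ρ → Valid E ρ → Valid (insert v E) ρ
  insert-valid v []      []      p _       = tt
  insert-valid v (r ∷ E) (y ∷ ρ) p (q , V) with euclid 20 r v | euclid-∣ 20 r v (y ∷ ρ) q p
  ... | s , x ∷ w | N∣s , N∣w with x ≟ 0ℤ
  ... | no  _    = N∣s , V
  ... | yes refl = N∣s , insert-valid w E ρ (∣-≡ (+-identityˡ _) N∣w) V

  reduce-χ : ∀ {d} (E : Echelon d) φ ρ → Valid E ρ → χ (reduce E φ · ρ) ≡ χ (φ · ρ)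
  reduce-χ E φ ρ V = χ-cong (≈-sym (reduce-≈ E φ ρ V))

  ⊝-χ : ∀ {d} (φ : Form d) ρ → χ ((⊝ φ) · ρ) ≡ χ (φ · ρ)
  ⊝-χ φ ρ = trans (cong χ (·-neg φ ρ)) (χ-neg (φ · ρ))

  normalize-χ : ∀ E φ ρ → Valid E ρ → χ (normalize E φ · ρ) ≡ χ (φ · ρ)
  normalize-χ E φ ρ V with reduce E φ <ᶠ reduce E (⊝ φ)
  ... | true  = trans (reduce-χ E (⊝ φ) ρ V) (⊝-χ φ ρ)
  ... | false = reduce-χ E φ ρ V

  upToSign-χ : ∀ φ ρ → χ (upToSign φ · ρ) ≡ χ (φ · ρ)
  upToSign-χ φ ρ with φ <ᶠ (⊝ φ)
  ... | true  = ⊝-χ φ ρ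
  ... | false = refl

  χ-∣ : ∀ {x y} → χ x ≡ χ y → N ∣ y → N ∣ x
  χ-∣ {x} eq p with toSum (N ∣? x)
  ... | inj₁ q  = q
  ... | inj₂ ¬q with () ← trans (sym (χ-no ¬q)) (trans eq (χ-yes p))

  ∣𝟎 : ∀ {d} {φ : Form d} ρ → φ ≡ 𝟎 → N ∣ φ · ρ
  ∣𝟎 ρ refl = ∣-≡ (sym (·-𝟎 ρ)) (divides 0ℤ refl)

  halves : ∀ q → ∃ λ h → q ≡ h + h ⊎ q ≡ 1ℤ + (h + h)
  halves q with q %ℕ 2 | n%ℕd<d q 2 | q /ℕ 2 | a≡a%ℕn+[a/ℕn]*n q 2
  ... | 0           | _ | h | eq = h , inj₁ (trans eq (lemma h))
    where
    lemma : ∀ h → + 0 + h * + 2 ≡ h + h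
    lemma = solve-∀
  ... | 1           | _ | h | eq = h , inj₂ (trans eq (lemma h))
    where
    lemma : ∀ h → + 1 + h * + 2 ≡ 1ℤ + (h + h)
    lemma = solve-∀
  ... | suc (suc _) | s≤s (s≤s ()) | _ | _

  double-injective : ∀ {x y} → x + x ≡ y + y → x ≡ y
  double-injective {x} {y} eq = *-cancelˡ-≡ (+ 2) x y (trans (lemma x) (trans eq (sym (lemma y))))
    where
    lemma : ∀ x → + 2 * x ≡ x + x
    lemma = solve-∀

  -- Write 2x = qN and 2y = rN. If q or r is even, then x or y is itself a multiple of N; if both
  -- are odd, q - r is even and x - y is one.
  unique-involution : ∀ {x y} → N ∣ x + x → N ∣ y + y → N ∣ x ⊎ N ∣ y ⊎ N ∣ x - y
  unique-involution {x} {y} (divides q p) (divides r p′) with halves q | halves r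
  ... | h , inj₁ refl | _             = inj₁ (divides h (double-injective (trans p (*-distribʳ-+ N h h))))
  ... | _             | k , inj₁ refl = inj₂ (inj₁ (divides k (double-injective (trans p′ (*-distribʳ-+ N k k)))))
  ... | h , inj₂ refl | k , inj₂ refl = inj₂ (inj₂ (divides (h - k) (double-injective
    (trans (lemma₁ x y) (trans (cong₂ _-_ p p′) (lemma₂ h k N))))))
    where
    lemma₁ : ∀ x y → (x - y) + (x - y) ≡ (x + x) - (y + y)
    lemma₁ = solve-∀
    lemma₂ : ∀ h k N → (1ℤ + (h + h)) * N - (1ℤ + (k + k)) * N ≡ (h - k) * N + (h - k) * N
    lemma₂ = solve-∀

  module _ (ρ : Vec ℤ 4) where

    Vanish Survive : Form 4 → Set
    Vanish φ = N ∣ φ · ρ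
    Survive φ = ¬ Vanish φ

    value : Table → ℤ
    value = val (λ φ → χ (φ · ρ))

    harmless-term : ∀ {Z} → All Survive Z → ∀ φ m → φ ≢ 𝟎 → T (harmless Z (φ , m)) → 0ℤ ≤ m * χ (φ · ρ)
    harmless-term {Z} Z≢0 φ m φ≢𝟎 ok with φ ≟ᶠ 𝟎
    ... | yes φ≡𝟎 = ⊥-elim (φ≢𝟎 φ≡𝟎)
    ... | no _ with toSum (N ∣? (φ · ρ)) | Equivalence.to T-∨ ok
    ... | inj₂ ¬p | _ = ≤-reflexive (sym (trans (cong (m *_) (χ-no ¬p)) (*-zeroʳ m)))
    ... | inj₁ p | inj₁ 0≤m =
      ≤-trans (T-does {a? = 0ℤ ≤? m} 0≤m) (≤-reflexive (sym (trans (cong (m *_) (χ-yes p)) (*-identityʳ m))))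
    ... | inj₁ p | inj₂ φ∈Z with find (T-does {a? = any? (φ ≟ᶠ_) Z} φ∈Z)
    ... | ψ , ψ∈Z , refl = ⊥-elim (All.lookup Z≢0 ψ∈Z p)

    constant≤value : ∀ {Z} → All Survive Z → ∀ S → T (all (harmless Z) S) → constant S ≤ value S
    constant≤value     Z≢0 []            _  = ≤-refl
    constant≤value {Z} Z≢0 ((φ , m) ∷ S) ok with T-× {harmless Z (φ , m)} ok
    ... | ok₁ , ok₂ with φ ≟ᶠ 𝟎 | harmless-term Z≢0 φ m | constant≤value Z≢0 S ok₂
    ... | yes φ≡𝟎 | _    | ih =
      +-mono-≤ (≤-reflexive (sym (trans (cong (m *_) (χ-yes (∣𝟎 ρ φ≡𝟎))) (*-identityʳ m)))) ih
    ... | no φ≢𝟎  | term | ih =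
      ≤-trans (≤-reflexive (sym (+-identityˡ _))) (+-mono-≤ (term φ≢𝟎 ok₁) ih)

    Balanced : Profile → Set
    Balanced P = ∃ λ v → ∀ i → value (lookup P i) ≡ v

    value-combine : ∀ {m} (cs : Vec ℤ m) P v → (∀ i → value (lookup P i) ≡ v) →
                    value (combine cs P) ≡ sumℤ cs * v
    value-combine []       []      v eq = refl
    value-combine (c ∷ cs) (S ∷ P) v eq = begin
      value (scale c S ++ combine cs P)        ≡⟨ val-++ _ (scale c S) _ ⟩
      value (scale c S) + value (combine cs P) ≡⟨ cong₂ _+_ (trans (val-scale _ c S) (cong (c *_) (eq zero)))
                                                            (value-combine cs P v (eq ∘ suc)) ⟩
      c * v + sumℤ cs * v                      ≡⟨ *-distribʳ-+ v c (sumℤ cs) ⟨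
      (c + sumℤ cs) * v                        ∎
      where open ≡-Reasoning

    balanced-nth : ∀ {Ps} → All Balanced Ps → ∀ k → Balanced (nth Ps k)
    balanced-nth []       k       = 0ℤ , λ i → cong value (lookup-replicate i [])
    balanced-nth (b ∷ bs) zero    = b
    balanced-nth (b ∷ bs) (suc k) = balanced-nth bs k

    normalize-survive : ∀ E → Valid E ρ → ∀ {Z} → All Survive Z → All Survive (map (normalize E) Z)
    normalize-survive E V = All.map⁺ ∘ All.map (λ {φ} ¬p p → ¬p (χ-∣ (sym (normalize-χ E φ ρ V)) p))

    outweighs-⊥ : ∀ {Z} → All Survive Z → ∀ S → value S ≡ 0ℤ → ¬ T (outweighs Z S)
    outweighs-⊥ {Z} Z≢0 S eq ok with T-× {does (0ℤ <? constant S)} ok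
    ... | ok₁ , ok₂ =
      <⇒≱ (T-does {a? = 0ℤ <? constant S} ok₁) (≤-trans (constant≤value Z≢0 S ok₂) (≤-reflexive eq))

    vanish-⇒ : ∀ E → Valid E ρ → ∀ φ → reduce E φ ≡ 𝟎 → Vanish φ
    vanish-⇒ E V φ eq = ≈-∣ (reduce-≈ E φ ρ V) (∣𝟎 ρ eq)

    check-sound : ∀ Ps → All Balanced Ps → ∀ E → Valid E ρ → ∀ Z → All Survive Z →
                  ∀ c → ¬ T (check Ps E Z c)
    check-sound Ps bal E V Z Z≢0 close ok with find (T-does {a? = any? (λ ψ → reduce E ψ ≟ᶠ 𝟎) Z} ok)
    ... | ψ , ψ∈Z , eq = All.lookup Z≢0 ψ∈Z (vanish-⇒ E V ψ eq)
    -- The six counts share the value `v`, so the combination equals the total weight times `v`,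
    -- which is 0, against its positive lower bound.
    check-sound Ps bal E V Z Z≢0 (weigh k cs) ok with T-× {does (sumℤ cs ≟ 0ℤ)} ok | balanced-nth bal k
    ... | ok₁ , ok₂ | v , eq = outweighs-⊥ (normalize-survive E V Z≢0)
      (collect (normalize E) (combine cs (nth Ps k)))
      (trans (val-collect _ (normalize E) (λ φ → normalize-χ E φ ρ V) (combine cs (nth Ps k)))
        (trans (value-combine cs (nth Ps k) v eq)
          (cong (_* v) (T-does {a? = sumℤ cs ≟ 0ℤ} ok₁)))) ok₂
    check-sound Ps bal E V Z Z≢0 (torsion φ ψ c₁ c₂ c₃) ok
      with ok₁ , ok   ← T-× {does (reduce E (φ ⊕ᶠ φ) ≟ᶠ 𝟎)} ok
      with ok₂ , ok   ← T-× {does (reduce E (ψ ⊕ᶠ ψ) ≟ᶠ 𝟎)} ok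
      with ok₃ , ok   ← T-× {check Ps (insert φ E) Z c₁} ok
      with ok₄ , ok₅  ← T-× {check Ps (insert ψ E) Z c₂} ok
      with unique-involution (double φ ok₁) (double ψ ok₂)
      where
      double : ∀ φ → T (does (reduce E (φ ⊕ᶠ φ) ≟ᶠ 𝟎)) → N ∣ φ · ρ + φ · ρ
      double φ t = ∣-≡ (·-+ φ φ ρ) (vanish-⇒ E V _ (T-does {a? = reduce E (φ ⊕ᶠ φ) ≟ᶠ 𝟎} t))
    ... | inj₁ p        = check-sound Ps bal _ (insert-valid φ E ρ p V) Z Z≢0 c₁ ok₃
    ... | inj₂ (inj₁ p) = check-sound Ps bal _ (insert-valid ψ E ρ p V) Z Z≢0 c₂ ok₄
    ... | inj₂ (inj₂ p) =
      check-sound Ps bal _ (insert-valid (φ ⊕ᶠ ⊝ ψ) E ρ (∣-≡ (sym difference) p) V) Z Z≢0 c₃ ok₅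
      where
      difference : (φ ⊕ᶠ ⊝ ψ) · ρ ≡ φ · ρ - ψ · ρ
      difference = trans (·-+ φ (⊝ ψ) ρ) (+-congˡ (φ · ρ) (·-neg ψ ρ))
    check-sound Ps bal E V Z Z≢0 (split φ c₁ c₂) ok with T-× {check Ps (insert φ E) Z c₁} ok | N ∣? (φ · ρ)
    ... | ok₁ , ok₂ | yes p = check-sound Ps bal _ (insert-valid φ E ρ p V) Z Z≢0 c₁ ok₁
    ... | ok₁ , ok₂ | no ¬p = check-sound Ps bal E V (φ ∷ Z) (¬p ∷ Z≢0) c₂ ok₂

-- Walks in graphs

sumOver : {X : Set} → (X → ℤ) → List X → ℤ
sumOver f []       = 0ℤ
sumOver f (x ∷ xs) = f x + sumOver f xs

sumOver-cong : ∀ {X : Set} {f g : X → ℤ} → (∀ x → f x ≡ g x) → ∀ xs → sumOver f xs ≡ sumOver g xs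
sumOver-cong eq []       = refl
sumOver-cong eq (x ∷ xs) = cong₂ _+_ (eq x) (sumOver-cong eq xs)

sumOver-map : ∀ {X Y : Set} (f : Y → ℤ) (h : X → Y) xs → sumOver f (map h xs) ≡ sumOver (f ∘ h) xs
sumOver-map f h []       = refl
sumOver-map f h (x ∷ xs) = +-congˡ (f (h x)) (sumOver-map f h xs)

sumOver-↭ : ∀ {X : Set} (f : X → ℤ) {xs ys} → xs ↭ ys → sumOver f xs ≡ sumOver f ys
sumOver-↭ f Perm.refl          = refl
sumOver-↭ f (prep x p)         = +-congˡ (f x) (sumOver-↭ f p)
sumOver-↭ f (swap {ys = ys} x y p)       =
  trans (+-congˡ (f x) (+-congˡ (f y) (sumOver-↭ f p))) (lemma (f x) (f y) (sumOver f ys))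
  where
  lemma : ∀ x y z → x + (y + z) ≡ y + (x + z)
  lemma = solve-∀
sumOver-↭ f (Perm.trans p q)   = trans (sumOver-↭ f p) (sumOver-↭ f q)

module Walks {V : Set} (_≟ⱽ_ : DecidableEquality V) where

  δ : V → V → ℤ
  δ u v = indicator (u ≟ⱽ v)

  -- In a 4-regular graph these are the numbers of non-backtracking walks of length k from u to t.
  walks : (V → List V) → ℕ → V → V → ℤ
  walks nb 0             u t = δ u t
  walks nb 1             u t = sumOver (λ w → δ w t) (nb u)
  walks nb (suc (suc k)) u t = sumOver (λ w → walks nb (suc k) w t) (nb u) + - backtracks k * walks nb k u t

  loops : (V → List V) → ℕ → V → V → ℤ
  loops nb k u v = walks nb k u v + walks nb k v u

  module _ (nb nb′ : V → List V) (φ : V → V) (inj : Injective _≡_ _≡_ φ)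
           (hom : ∀ u → map φ (nb u) ↭ nb′ (φ u)) where

    δ-φ : ∀ u v → δ u v ≡ δ (φ u) (φ v)
    δ-φ u v with u ≟ⱽ v
    ... | yes refl = sym (indicator-yes (φ u ≟ⱽ φ u) refl)
    ... | no u≢v   = sym (indicator-no (φ u ≟ⱽ φ v) (u≢v ∘ inj))

    sumOver-φ : ∀ {f g : V → ℤ} → (∀ w → f w ≡ g (φ w)) → ∀ u → sumOver f (nb u) ≡ sumOver g (nb′ (φ u))
    sumOver-φ {g = g} eq u =
      trans (sumOver-cong eq (nb u)) (trans (sym (sumOver-map g φ (nb u))) (sumOver-↭ g (hom u)))

    -- The recurrence sees neighbour lists only through sums, hence up to permutation. This serves
    -- both for automorphisms, where `nb` and `nb′` agree, and for symmetries of the parameters,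
    -- where `φ` is the identity.
    walks-φ : ∀ k u t → walks nb k u t ≡ walks nb′ k (φ u) (φ t)
    walks-φ 0             u t = δ-φ u t
    walks-φ 1             u t = sumOver-φ (λ w → δ-φ w t) u
    walks-φ (suc (suc k)) u t =
      cong₂ _+_ (sumOver-φ (λ w → walks-φ (suc k) w t) u) (cong (- backtracks k *_) (walks-φ k u t))

    loops-φ : ∀ k u v → loops nb k u v ≡ loops nb′ k (φ u) (φ v)
    loops-φ k u v = cong₂ _+_ (walks-φ k u v) (walks-φ k v u)

-- Vertices by part and index

part : ∀ {n} → Vtx n → Part
part (A _) = 𝔸
part (B _) = 𝔹
part (C _) = ℂ

index : ∀ {n} → Vtx n → Fin n
index (A i) = i
index (B i) = i
index (C i) = i

vertex : ∀ {n} → Part → Fin n → Vtx n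
vertex 𝔸 = A
vertex 𝔹 = B
vertex ℂ = C

vertex-η : ∀ {n} (u : Vtx n) → vertex (part u) (index u) ≡ u
vertex-η (A _) = refl
vertex-η (B _) = refl
vertex-η (C _) = refl

part-vertex : ∀ {n} s (i : Fin n) → part (vertex s i) ≡ s
part-vertex 𝔸 i = refl
part-vertex 𝔹 i = refl
part-vertex ℂ i = refl

index-vertex : ∀ {n} s (i : Fin n) → index (vertex s i) ≡ i
index-vertex 𝔸 i = refl
index-vertex 𝔹 i = refl
index-vertex ℂ i = refl

_≟ⱽ_ : ∀ {n} → DecidableEquality (Vtx n)
u ≟ⱽ v = map′ to (λ { refl → refl , refl }) (part u Fin.≟ part v ×-dec index u Fin.≟ index v)
  where
  open import Relation.Nullary.Decidable using (_×-dec_)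
  to : part u ≡ part v × index u ≡ index v → u ≡ v
  to (p , q) = trans (sym (vertex-η u)) (trans (cong₂ vertex p q) (vertex-η v))

-- Integers as indices, and walk counts as values of tables

module Residues (n : ℕ) .{{_ : NonZero n}} where
  N : ℤ
  N = + n

  open Modular N public

  ι : ℤ → Fin n
  ι z = fromℕ< (n%ℕd<d z n)

  rep : Fin n → ℤ
  rep i = + toℕ i

  rep-ι : ∀ z → z ≈ rep (ι z)
  rep-ι z = congruent (divides (z /ℕ n)
    (trans (cong₂ _-_ (a≡a%ℕn+[a/ℕn]*n z n) (cong +_ (toℕ-fromℕ< (n%ℕd<d z n)))) (lemma (+ (z %ℕ n)) _)))
    where
    lemma : ∀ r q → (r + q) - r ≡ q
    lemma = solve-∀

  -- Both representatives lie between 0 and n - 1, so their difference is a multiple of n of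
  -- absolute value less than n.
  rep-injective : ∀ {i j} → rep i ≈ rep j → i ≡ j
  rep-injective {i} {j} (congruent p) =
    toℕ-injective (+-injective (i-j≡0⇒i≡j (rep i) (rep j) (∣i∣≡0⇒i≡0 (small (∣⇒∣ᵤ p) bound))))
    where
    bound : ℤ.∣ rep i - rep j ∣ ℕ.< n
    bound = ℕ.≤-<-trans
      (ℕ.≤-trans (ℕ.≤-reflexive (cong ℤ.∣_∣ (m-n≡m⊖n (toℕ i) (toℕ j)))) (∣m⊝n∣≤m⊔n (toℕ i) (toℕ j)))
      (ℕ.⊔-lub (toℕ<n i) (toℕ<n j))
    small : ∀ {k} → n ℕ.∣ k → k ℕ.< n → k ≡ 0
    small {zero}  _   _   = refl
    small {suc k} n∣k k<n = ⊥-elim (ℕ.>⇒∤ k<n n∣k)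

  ι-cong : ∀ {x y} → x ≈ y → ι x ≡ ι y
  ι-cong {x} {y} p = rep-injective (≈-trans (≈-sym (rep-ι x)) (≈-trans p (rep-ι y)))

  ι-injective : ∀ {x y} → ι x ≡ ι y → x ≈ y
  ι-injective {x} {y} eq = ≈-trans (rep-ι x) (subst (λ i → rep i ≈ y) (sym eq) (≈-sym (rep-ι y)))

  ι-pos : ∀ i → ι (rep i) ≡ i
  ι-pos i = rep-injective (≈-sym (rep-ι (rep i)))

  at : Part → ℤ → Vtx n
  at s z = vertex s (ι z)

  +-≈ : ∀ {x y} z → x ≈ y → x + z ≈ y + z
  +-≈ {x} {y} z (congruent p) = congruent (∣-≡ (lemma x y z) p)
    where
    lemma : ∀ x y z → x - y ≡ (x + z) - (y + z)
    lemma = solve-∀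

  open Walks (_≟ⱽ_ {n}) public

  δ-at : ∀ s t z y → δ (at s z) (at t y) ≡ (if does (s Fin.≟ t) then χ (z - y) else 0ℤ)
  δ-at s t z y with s Fin.≟ t
  ... | no s≢t = indicator-no (at s z ≟ⱽ at t y)
    (λ eq → s≢t (trans (sym (part-vertex s _)) (trans (cong part eq) (part-vertex t _))))
  ... | yes refl with toSum (N ∣? (z - y))
  ... | inj₁ p  = trans
    (indicator-yes (at s z ≟ⱽ at s y) (cong (vertex s) (ι-cong {z} {y} (congruent p))))
    (sym (χ-yes p))
  ... | inj₂ ¬p = trans (indicator-no (at s z ≟ⱽ at s y)
    (λ eq → ¬p (_≈_.difference (ι-injective {z} {y}
      (trans (sym (index-vertex s _)) (trans (cong index eq) (index-vertex s _)))))))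
    (sym (χ-no ¬p))

  module Neighbours (ρ : Vec ℤ 4) where

    along : ℤ → Dart → Vtx n
    along z (t , v) = at t (z + v · ρ)

    nb : Vtx n → List (Vtx n)
    nb u = map (along (rep (index u))) (darts (part u))

    along-cong : ∀ {x y} → x ≈ y → ∀ d → along x d ≡ along y d
    along-cong p (t , v) = cong (vertex t) (ι-cong (+-≈ (v · ρ) p))

    -- `nb` starts from the canonical representative of an index; any other integer in the class
    -- gives the same vertices.
    nb-at : ∀ s z → nb (at s z) ≡ map (along z) (darts s)
    nb-at s z rewrite part-vertex s (ι z) | index-vertex s (ι z) =
      map-cong (along-cong (≈-sym (rep-ι z))) (darts s)

    -- With x = z - y this indicates whether a walk of voltage φ starting at index z ends at index
    -- y.
    hit : ℤ → Form 4 → ℤ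
    hit x φ = χ (x + φ · ρ)

    Counts : ℕ → Level → Set
    Counts k G = ∀ s t z y → walks nb k (at s z) (at t y) ≡ val (hit (z - y)) (G ! (s , t))

    !-tabulate : ∀ f s t → tabulate₂ f ! (s , t) ≡ f s t
    !-tabulate f s t = trans (cong (λ r → lookup r t) (lookup∘tabulate (λ s → Vec.tabulate (f s)) s))
                             (lookup∘tabulate (f s) t)

    counts-level₀ : Counts 0 level₀
    counts-level₀ s t z y =
      trans (δ-at s t z y) (trans go (cong (val (hit (z - y))) (sym (!-tabulate stationary s t))))
      where
      go : (if does (s Fin.≟ t) then χ (z - y) else 0ℤ) ≡
           val (hit (z - y)) (if does (s Fin.≟ t) then (𝟎 , 1ℤ) ∷ [] else [])
      go with does (s Fin.≟ t)
      ... | false = refl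
      ... | true  = sym (trans (+-identityʳ _) (trans (*-identityˡ _)
        (cong χ (trans (+-congˡ (z - y) (·-𝟎 ρ)) (+-identityʳ _)))))

    val-shift : ∀ x v T → val (hit x) (transform (v ⊕ᶠ_) 1ℤ T) ≡ val (hit (x + v · ρ)) T
    val-shift x v T = trans (val-transform (hit x) (v ⊕ᶠ_) 1ℤ T) (trans (*-identityˡ _)
      (val-cong (λ φ → cong χ (trans (+-congˡ x (·-+ v φ ρ)) (sym (+-assoc x (v · ρ) (φ · ρ))))) T))

    val-extend : ∀ k G → Counts k G → ∀ s t z y →
                 sumOver (λ w → walks nb k w (at t y)) (nb (at s z)) ≡ val (hit (z - y)) (extend G s t)
    val-extend k G counts s t z y =
      trans (cong (sumOver _) (nb-at s z)) (trans (sumOver-map _ (along z) (darts s)) (go (darts s)))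
      where
      go : ∀ ds → sumOver (λ d → walks nb k (along z d) (at t y)) ds ≡
           val (hit (z - y)) (foldr (λ { (s′ , v) → transform (v ⊕ᶠ_) 1ℤ (G ! (s′ , t)) ⊹_ }) [] ds)
      go []              = refl
      go ((s′ , v) ∷ ds) = sym (trans (val-⊹ (hit (z - y)) (transform (v ⊕ᶠ_) 1ℤ (G ! (s′ , t))) _)
        (cong₂ _+_ (trans (val-shift (z - y) v (G ! (s′ , t)))
                     (trans (val-cong (λ φ → cong (λ x → hit x φ) (lemma z y (v · ρ))) (G ! (s′ , t)))
                            (sym (counts s′ t (z + v · ρ) y))))
                   (sym (go ds))))
        where
        lemma : ∀ z y v → (z - y) + v ≡ (z + v) - y
        lemma = solve-∀

    counts-level₁ : Counts 1 level₁
    counts-level₁ s t z y = trans (val-extend 0 level₀ counts-level₀ s t z y)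
                                  (cong (val (hit (z - y))) (sym (!-tabulate (extend level₀) s t)))

    counts-next : ∀ k G H → Counts k G → Counts (suc k) H → Counts (suc (suc k)) (next k G H)
    counts-next k G H cG cH s t z y = trans
      (cong₂ _+_ (val-extend (suc k) H cH s t z y)
                 (trans (cong (- backtracks k *_) (cG s t z y))
                        (sym (val-transform f id (- backtracks k) (G ! (s , t))))))
      (trans (sym (val-⊹ f (extend H s t) (transform id (- backtracks k) (G ! (s , t)))))
             (cong (val f) (sym (!-tabulate (recur k G H) s t))))
      where
      f = hit (z - y)

    -- A walk of voltage φ from the tail ends at the head exactly when n divides the value of φ - v;
    -- in the other direction the form is φ + v.
    val-edgeTable : ∀ k G → Counts k G → ∀ s t v →
      loops nb k (at s 0ℤ) (along 0ℤ (t , v)) ≡ value ρ (edgeTable G (s , t , v))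
    val-edgeTable k G counts s t v = sym (trans
      (val-collect f upToSign (λ φ → upToSign-χ φ ρ) (S ++ R))
      (trans (val-++ f S R) (cong₂ _+_
        (trans (transformed (⊝ v) (0ℤ - x) (trans (·-neg v ρ) (lemma₁ (v · ρ))) (G ! (s , t)))
               (sym (counts s t 0ℤ x)))
        (trans (transformed v (x - 0ℤ) (lemma₂ (v · ρ)) (G ! (t , s))) (sym (counts t s x 0ℤ))))))
      where
      f : Form 4 → ℤ
      f φ = χ (φ · ρ)
      x = 0ℤ + v · ρ
      S = transform (⊝ v ⊕ᶠ_) 1ℤ (G ! (s , t))
      R = transform (v ⊕ᶠ_) 1ℤ (G ! (t , s))
      lemma₁ : ∀ v → - v ≡ 0ℤ - (0ℤ + v)
      lemma₁ = solve-∀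
      lemma₂ : ∀ v → v ≡ (0ℤ + v) - 0ℤ
      lemma₂ = solve-∀
      transformed : ∀ v y → v · ρ ≡ y → ∀ T → val f (transform (v ⊕ᶠ_) 1ℤ T) ≡ val (hit y) T
      transformed v y eq T = trans (val-transform f (v ⊕ᶠ_) 1ℤ T) (trans (*-identityˡ _)
        (val-cong (λ φ → cong χ (trans (·-+ v φ ρ) (cong (λ t → t + φ · ρ) eq))) T))

    -- All that is retained of edge-transitivity. It makes sense for every integer vector ρ, such as
    -- one with a negative first entry, and so can be carried along the symmetries.
    Homogeneous : Set
    Homogeneous = ∀ k u v x y → v ∈ nb u → y ∈ nb x → loops nb k u v ≡ loops nb k x y

    edge∈nb : ∀ i → let (s , d) = lookup edges i in along 0ℤ d ∈ nb (at s 0ℤ)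
    edge∈nb i = subst (along 0ℤ (proj₂ (lookup edges i)) ∈_) (sym (nb-at _ 0ℤ)) (∈-map⁺ (along 0ℤ) (dart i))
      where
      dart : ∀ i → proj₂ (lookup edges i) ∈ darts (proj₁ (lookup edges i))
      dart zero                                = here refl
      dart (suc zero)                          = there (there (here refl))
      dart (suc (suc zero))                    = there (there (there (here refl)))
      dart (suc (suc (suc zero)))              = there (here refl)
      dart (suc (suc (suc (suc zero))))        = there (there (here refl))
      dart (suc (suc (suc (suc (suc zero)))))  = there (there (there (here refl)))

    profile-balanced : Homogeneous → ∀ k G → Counts k G → Balanced ρ (Vec.map (edgeTable G) edges)
    profile-balanced hom k G counts =
      loops nb k (at 𝔸 0ℤ) (along 0ℤ (𝔸 , a⁺)) , λ i →
        trans (cong (value ρ) (lookup-map i (edgeTable G) edges))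
          (trans (sym (val-edgeTable k G counts _ _ _)) (hom k _ _ _ _ (edge∈nb i) (edge∈nb zero)))

    profiles-balanced : Homogeneous → ∀ j k G H → Counts k G → Counts (suc k) H →
                        All (Balanced ρ) (profiles j k G H)
    profiles-balanced hom zero    k G H cG cH = []
    profiles-balanced hom (suc j) k G H cG cH =
      profile-balanced hom k G cG ∷ profiles-balanced hom j (suc k) H (next k G H) cH (counts-next k G H cG cH)

-- The case tree

module CaseTree where
  open import Agda.Builtin.FromNat using (Number; fromNat)
  open import Agda.Builtin.FromNeg using (Negative; fromNeg)
  import Data.Integer.Literals as ℤ-Literals
  import Data.Nat.Literals as ℕ-Literals

  instance
    numberℕ = ℕ-Literals.number
    numberℤ = ℤ-Literals.number
    negativeℤ = ℤ-Literals.negative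

  ⟨_,_,_,_⟩ : ℤ → ℤ → ℤ → ℤ → Form 4
  ⟨ p , q , r , s ⟩ = p ∷ q ∷ r ∷ s ∷ []

  layers : List Layer
  layers =
    -- If d = 0, then A_0B_0 lies in a triangle with C_0, but B_0C_b lies in none since b ≠ d.
    ( ⟨ 0 , 0 , 0 , 1 ⟩ ,
      (weigh 2 (0 ∷ 1 ∷ 0 ∷ -1 ∷ 0 ∷ 0 ∷ [])) ) ∷
    ( ⟨ 1 , 0 , 0 , 0 ⟩ ,
      close ) ∷
    -- If 3a = 0, then A_0A_a lies in a triangle, while A_0B_0 does not because b, c, d are nonzero.
    ( ⟨ 3 , 0 , 0 , 0 ⟩ ,
      (weigh 2 (1 ∷ -1 ∷ 0 ∷ 0 ∷ 0 ∷ 0 ∷ [])) ) ∷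
    -- If 4a = 0, then A_0A_a lies in a 4-cycle of A's; the 4-cycles due to b, c or d being ±a count
    -- equally at A_0A_a and A_0B_0.
    ( ⟨ 4 , 0 , 0 , 0 ⟩ ,
      (weigh 3 (1 ∷ -1 ∷ 0 ∷ 0 ∷ 0 ∷ 0 ∷ [])) ) ∷
    ( ⟨ 1 , -1 , 0 , 0 ⟩ ,
      (split ⟨ 0 , 1 , 1 , -2 ⟩
        (split ⟨ 0 , 0 , 1 , -3 ⟩
          (weigh 3 (0 ∷ 0 ∷ 0 ∷ 1 ∷ -1 ∷ 0 ∷ []))
        (split ⟨ 0 , 0 , 3 , -3 ⟩
          (weigh 3 (0 ∷ 0 ∷ 0 ∷ 1 ∷ 0 ∷ -1 ∷ []))
        (split ⟨ 0 , 0 , 0 , 2 ⟩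
          (split ⟨ 0 , 0 , 6 , 0 ⟩
            -- Here a = b = -c, 2d = 0 and 6c = 0. The branches give d = 0, 3a = 0, and 3c = 3d
            -- (from d = 3c), each excluded before.
            (torsion ⟨ 0 , 0 , 0 , 1 ⟩ ⟨ 0 , 0 , 3 , 0 ⟩
              close close close)
          (weigh 5 (-1 ∷ 1 ∷ 0 ∷ 0 ∷ 0 ∷ 0 ∷ [])))
        (weigh 3 (-1 ∷ 0 ∷ 0 ∷ 1 ∷ 0 ∷ 0 ∷ [])))))
      (split ⟨ 0 , 2 , -1 , -1 ⟩
        (split ⟨ 0 , 1 , 1 , 0 ⟩
          (weigh 3 (-1 ∷ 0 ∷ 0 ∷ 1 ∷ 0 ∷ 0 ∷ []))
        (split ⟨ 0 , 1 , 0 , 1 ⟩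
          (weigh 3 (-1 ∷ 0 ∷ 0 ∷ 1 ∷ 0 ∷ 0 ∷ []))
        (weigh 3 (-1 ∷ 0 ∷ 0 ∷ 1 ∷ 0 ∷ 0 ∷ []))))
      (split ⟨ 0 , 1 , -2 , 1 ⟩
        (split ⟨ 0 , 0 , 3 , -1 ⟩
          (weigh 3 (0 ∷ 0 ∷ 0 ∷ 1 ∷ 0 ∷ -1 ∷ []))
        (split ⟨ 0 , 0 , 2 , 0 ⟩
          (split ⟨ 0 , 0 , 0 , 6 ⟩
            (torsion ⟨ 0 , 0 , 0 , 3 ⟩ ⟨ 0 , 0 , 1 , 0 ⟩
              close close close)
          (weigh 5 (-1 ∷ 1 ∷ 0 ∷ 0 ∷ 0 ∷ 0 ∷ [])))
        (weigh 3 (-1 ∷ 0 ∷ 0 ∷ 1 ∷ 0 ∷ 0 ∷ []))))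
      (split ⟨ 0 , 1 , 1 , 0 ⟩
        (weigh 5 (1 ∷ -4 ∷ 0 ∷ 1 ∷ 1 ∷ 1 ∷ []))
      (split ⟨ 0 , 1 , 0 , 1 ⟩
        (weigh 5 (1 ∷ -4 ∷ 0 ∷ 1 ∷ 1 ∷ 1 ∷ []))
      (split ⟨ 0 , 2 , 0 , -2 ⟩
        (weigh 3 (-1 ∷ 0 ∷ 0 ∷ 1 ∷ 0 ∷ 0 ∷ []))
      (split ⟨ 0 , 2 , -2 , 0 ⟩
        (weigh 3 (1 ∷ 0 ∷ 0 ∷ 0 ∷ 0 ∷ -1 ∷ []))
      (split ⟨ 0 , 0 , 2 , -2 ⟩
        (split ⟨ 0 , 2 , 1 , -1 ⟩
          close
        (split ⟨ 0 , 3 , 0 , -1 ⟩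
          (weigh 5 (1 ∷ -1 ∷ 0 ∷ 0 ∷ 0 ∷ 0 ∷ []))
        (split ⟨ 0 , 3 , 1 , -2 ⟩
          (weigh 5 (1 ∷ -1 ∷ 0 ∷ 0 ∷ 0 ∷ 0 ∷ []))
        (split ⟨ 0 , 3 , 1 , 0 ⟩
          (weigh 5 (1 ∷ -1 ∷ 0 ∷ 0 ∷ 0 ∷ 0 ∷ []))
        (split ⟨ 0 , 3 , 0 , 1 ⟩
          (weigh 5 (1 ∷ -1 ∷ 0 ∷ 0 ∷ 0 ∷ 0 ∷ []))
        (split ⟨ 0 , 0 , 0 , 2 ⟩
          (weigh 5 (0 ∷ -1 ∷ 0 ∷ 1 ∷ 0 ∷ 0 ∷ []))
        (split ⟨ 0 , 0 , 1 , 1 ⟩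
          (weigh 5 (0 ∷ -1 ∷ 0 ∷ 1 ∷ 0 ∷ 0 ∷ []))
        (split ⟨ 0 , 6 , 0 , 0 ⟩
          (weigh 5 (1 ∷ -1 ∷ 0 ∷ 0 ∷ 0 ∷ 0 ∷ []))
        (weigh 5 (-1 ∷ 0 ∷ 0 ∷ 1 ∷ 0 ∷ 0 ∷ []))))))))))
      (weigh 3 (1 ∷ 0 ∷ 0 ∷ 0 ∷ -1 ∷ 0 ∷ [])))))))))) ) ∷
    -- By now A_0A_a lies in no 4-cycle, since 4a ≠ 0 and none of b, c, d is ±a. This form and the
    -- next would put an edge BC into a 4-cycle of B's and C's.
    ( ⟨ 0 , 0 , 2 , -2 ⟩ ,
      (weigh 3 (-1 ∷ 0 ∷ 0 ∷ 0 ∷ 1 ∷ 0 ∷ [])) ) ∷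
    ( ⟨ 0 , 1 , -2 , 1 ⟩ ,
      (weigh 3 (-1 ∷ 0 ∷ 0 ∷ 1 ∷ 0 ∷ 0 ∷ [])) ) ∷
    -- The forms excluded so far leave girth at least 5. Summing weights along 5-cycles, AAAAA and
    -- ABCBC get 0, AABCB and AACBC occur equally often and get 4 and -2, and AAABC, present because
    -- 2a = b, gets 3 - 1.
    ( ⟨ 2 , -1 , 0 , 0 ⟩ ,
      (weigh 4 (0 ∷ 3 ∷ 0 ∷ -1 ∷ -1 ∷ -1 ∷ [])) ) ∷
    ( ⟨ 0 , 1 , -1 , -1 ⟩ ,
      (split ⟨ 5 , 0 , 0 , 0 ⟩
        (weigh 4 (-1 ∷ 1 ∷ 0 ∷ 0 ∷ 0 ∷ 0 ∷ []))
      (weigh 4 (-1 ∷ 1 ∷ 0 ∷ 0 ∷ 0 ∷ 0 ∷ []))) ) ∷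
    ( ⟨ 0 , 0 , 1 , -2 ⟩ ,
      (split ⟨ 0 , 2 , 0 , -1 ⟩
        (weigh 5 (1 ∷ -4 ∷ 0 ∷ 1 ∷ 1 ∷ 1 ∷ []))
      (split ⟨ 0 , 1 , 0 , -4 ⟩
        (weigh 4 (0 ∷ 1 ∷ 0 ∷ -1 ∷ 0 ∷ 0 ∷ []))
      (split ⟨ 5 , 0 , 0 , 0 ⟩
        (weigh 4 (1 ∷ 0 ∷ 0 ∷ -1 ∷ 0 ∷ 0 ∷ []))
      (weigh 4 (-1 ∷ 1 ∷ 0 ∷ 0 ∷ 0 ∷ 0 ∷ []))))) ) ∷
    ( ⟨ 0 , 0 , 0 , 2 ⟩ ,
      (weigh 5 (1 ∷ -4 ∷ 0 ∷ 1 ∷ 1 ∷ 1 ∷ [])) ) ∷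
    ( ⟨ 0 , 0 , 3 , -3 ⟩ ,
      (split ⟨ 0 , 1 , 1 , 0 ⟩
        (weigh 5 (1 ∷ -4 ∷ 0 ∷ 1 ∷ 1 ∷ 1 ∷ []))
      (split ⟨ 0 , 1 , 0 , 1 ⟩
        (weigh 5 (1 ∷ -4 ∷ 0 ∷ 1 ∷ 1 ∷ 1 ∷ []))
      (split ⟨ 0 , 0 , 2 , -4 ⟩
        (weigh 5 (1 ∷ -4 ∷ 0 ∷ 1 ∷ 1 ∷ 1 ∷ []))
      (weigh 5 (1 ∷ -4 ∷ 0 ∷ 1 ∷ 1 ∷ 1 ∷ []))))) ) ∷
    ( ⟨ 0 , 1 , -3 , 2 ⟩ ,
      (split ⟨ 0 , 0 , 1 , 1 ⟩
        (weigh 5 (1 ∷ -4 ∷ 0 ∷ 1 ∷ 1 ∷ 1 ∷ []))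
      (split ⟨ 0 , 0 , 3 , -1 ⟩
        (weigh 5 (1 ∷ -4 ∷ 0 ∷ 1 ∷ 1 ∷ 1 ∷ []))
      (split ⟨ 0 , 0 , 4 , -2 ⟩
        (weigh 5 (1 ∷ -4 ∷ 0 ∷ 1 ∷ 1 ∷ 1 ∷ []))
      (weigh 5 (1 ∷ -4 ∷ 0 ∷ 1 ∷ 1 ∷ 1 ∷ []))))) ) ∷
    ( ⟨ 1 , -2 , 0 , 1 ⟩ ,
      (split ⟨ 0 , 3 , 1 , -2 ⟩
        (weigh 5 (1 ∷ -1 ∷ 0 ∷ 0 ∷ 0 ∷ 0 ∷ []))
      (split ⟨ 0 , 1 , 0 , 1 ⟩
        (weigh 5 (0 ∷ 1 ∷ 0 ∷ 0 ∷ -1 ∷ 0 ∷ []))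
      (split ⟨ 0 , 6 , -1 , -3 ⟩
        (weigh 5 (1 ∷ -1 ∷ 0 ∷ 0 ∷ 0 ∷ 0 ∷ []))
      (split ⟨ 0 , 6 , 1 , -3 ⟩
        (weigh 5 (1 ∷ -1 ∷ 0 ∷ 0 ∷ 0 ∷ 0 ∷ []))
      (split ⟨ 0 , 1 , 1 , 0 ⟩
        (weigh 5 (0 ∷ 0 ∷ 0 ∷ 1 ∷ -1 ∷ 0 ∷ []))
      (split ⟨ 0 , 1 , 2 , -1 ⟩
        (weigh 5 (0 ∷ 0 ∷ 0 ∷ 1 ∷ -1 ∷ 0 ∷ []))
      (split ⟨ 0 , 2 , 2 , -2 ⟩
        (weigh 5 (1 ∷ -4 ∷ 0 ∷ 1 ∷ 1 ∷ 1 ∷ []))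
      (split ⟨ 0 , 5 , -1 , -2 ⟩
        (weigh 5 (-1 ∷ 0 ∷ 0 ∷ 1 ∷ 0 ∷ 0 ∷ []))
      (split ⟨ 0 , 4 , -1 , -1 ⟩
        (split ⟨ 0 , 0 , 1 , 1 ⟩
          (split ⟨ 0 , 2 , 0 , 6 ⟩
            -- Since c = -d, one has 4b = c + d = 0 and 12d = -4b = 0. The branches give 2b = 0, 3b
            -- + c = 2d and b + 2c = d, each excluded before.
            (torsion ⟨ 0 , 0 , 0 , 6 ⟩ ⟨ 0 , 1 , 0 , 3 ⟩
              close close close)
          (split ⟨ 0 , 0 , 0 , 8 ⟩
            (torsion ⟨ 0 , 0 , 0 , 4 ⟩ ⟨ 0 , 2 , 0 , 0 ⟩
              close close close)
          (weigh 7 (-1 ∷ 1 ∷ 0 ∷ 0 ∷ 0 ∷ 0 ∷ []))))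
        (weigh 5 (1 ∷ -1 ∷ 0 ∷ 0 ∷ 0 ∷ 0 ∷ [])))
      (weigh 5 (0 ∷ 0 ∷ 0 ∷ 0 ∷ -1 ∷ 1 ∷ []))))))))))) ) ∷
    ( ⟨ 2 , -1 , 0 , 1 ⟩ ,
      (split ⟨ 0 , 1 , 1 , 0 ⟩
        (weigh 5 (1 ∷ 0 ∷ 0 ∷ 0 ∷ -1 ∷ 0 ∷ []))
      (split ⟨ 0 , 1 , 0 , 1 ⟩
        (weigh 5 (1 ∷ 0 ∷ 0 ∷ 0 ∷ -1 ∷ 0 ∷ []))
      (split ⟨ 0 , 0 , 1 , 1 ⟩
        (weigh 5 (1 ∷ 0 ∷ 0 ∷ 0 ∷ -1 ∷ 0 ∷ []))
      (weigh 5 (1 ∷ -1 ∷ 0 ∷ 0 ∷ 0 ∷ 0 ∷ []))))) ) ∷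
    ( ⟨ 3 , -1 , 0 , 0 ⟩ ,
      (split ⟨ 0 , 0 , 1 , 1 ⟩
        (split ⟨ 2 , 2 , 0 , 0 ⟩
          (weigh 7 (1 ∷ -1 ∷ 0 ∷ 0 ∷ 0 ∷ 0 ∷ []))
        (split ⟨ 2 , 0 , 0 , 4 ⟩
          (weigh 7 (-5 ∷ 2 ∷ 0 ∷ 1 ∷ 1 ∷ 1 ∷ []))
        (split ⟨ 2 , 0 , 0 , -4 ⟩
          (weigh 7 (-5 ∷ 2 ∷ 0 ∷ 1 ∷ 1 ∷ 1 ∷ []))
        (split ⟨ 2 , 1 , 0 , 3 ⟩
          (weigh 7 (-1 ∷ 1 ∷ 0 ∷ 0 ∷ 0 ∷ 0 ∷ []))
        (split ⟨ 2 , 1 , 0 , -3 ⟩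
          (weigh 7 (-1 ∷ 1 ∷ 0 ∷ 0 ∷ 0 ∷ 0 ∷ []))
        (split ⟨ 2 , 2 , 0 , 2 ⟩
          (weigh 7 (-1 ∷ 1 ∷ 0 ∷ 0 ∷ 0 ∷ 0 ∷ []))
        (split ⟨ 2 , 2 , 0 , -2 ⟩
          (weigh 7 (-1 ∷ 1 ∷ 0 ∷ 0 ∷ 0 ∷ 0 ∷ []))
        (weigh 7 (-1 ∷ 1 ∷ 0 ∷ 0 ∷ 0 ∷ 0 ∷ [])))))))))
      (weigh 5 (1 ∷ -1 ∷ 0 ∷ 0 ∷ 0 ∷ 0 ∷ []))) ) ∷
    ( ⟨ 0 , 0 , 1 , 1 ⟩ ,
      (weigh 5 (0 ∷ -1 ∷ 0 ∷ 0 ∷ 1 ∷ 0 ∷ [])) ) ∷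
    []

  -- The identity x - y + z - x + y - z = 0 puts B_0C_b on hexagons of B's and C's. For x, y, z
  -- among b, c, d, a hexagon through A_0B_0 needs 3a = ±x, 2a = ±(x - y), x + y = 0 or a = ±(x - y
  -- + z). What is not excluded is the last with x, y, z distinct, and such a hexagon has one edge
  -- AB and one edge BC_b.
  last : Certificate
  last =
    (weigh 5 (0 ∷ -1 ∷ 0 ∷ 1 ∷ 0 ∷ 0 ∷ []))

open CaseTree using (layers; last)

-- The case analysis is carried out by evaluation. Eight profiles cover the lengths 0 to 7.
certified : refute (profiles 8 0 level₀ level₁) seeds layers last ≡ true
certified = refl

-- Symmetries of the parameters

-- `adjoint` trades a change of the form for a change of the parameters, `permutes` keeps the graph,
-- and `stable` keeps the hypotheses on the parameters, up to sign.
record Symmetry (σ : Form 4 → Form 4) : Set where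
  field
    adjoint  : ∀ φ ρ → σ φ · ρ ≡ φ · σ ρ
    permutes : ∀ s → map (map₂ σ) (darts s) ↭ darts s
    stable   : All (λ φ → Any (λ ψ → σ φ ≡ ψ ⊎ σ φ ≡ ⊝ ψ) seeds) seeds

neg₁-symmetry : Symmetry neg₁
neg₁-symmetry = record
  { adjoint  = λ { (p ∷ q ∷ r ∷ s ∷ []) (a ∷ b ∷ c ∷ d ∷ []) → adjoint p q r s a b c d }
  ; permutes = λ { 𝔸 → swap _ _ ↭-refl ; 𝔹 → ↭-refl ; ℂ → ↭-refl }
  ; stable   = here (inj₂ refl) ∷ there (here (inj₁ refl)) ∷ there (there (here (inj₁ refl)))
             ∷ there (there (there (here (inj₁ refl)))) ∷ []
  }
  where
  adjoint : ∀ p q r s a b c d → - p * a + (q * b + (r * c + (s * d + 0ℤ)))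
                              ≡ p * - a + (q * b + (r * c + (s * d + 0ℤ)))
  adjoint = solve-∀

swap₂-symmetry : Symmetry swap₂
swap₂-symmetry = record
  { adjoint  = λ { (p ∷ q ∷ r ∷ s ∷ []) (a ∷ b ∷ c ∷ d ∷ []) → adjoint p q r s a b c d }
  ; permutes = λ { 𝔸 → ↭-refl ; 𝔹 → prep _ (swap _ _ ↭-refl) ; ℂ → prep _ (swap _ _ ↭-refl) }
  ; stable   = here (inj₁ refl) ∷ there (here (inj₂ refl)) ∷ there (there (there (here (inj₁ refl))))
             ∷ there (there (here (inj₁ refl))) ∷ []
  }
  where
  adjoint : ∀ p q r s a b c d → p * a + (r * b + (q * c + (s * d + 0ℤ)))
                              ≡ p * a + (q * c + (r * b + (s * d + 0ℤ)))
  adjoint = solve-∀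

swap₃-symmetry : Symmetry swap₃
swap₃-symmetry = record
  { adjoint  = λ { (p ∷ q ∷ r ∷ s ∷ []) (a ∷ b ∷ c ∷ d ∷ []) → adjoint p q r s a b c d }
  ; permutes = λ { 𝔸 → ↭-refl ; 𝔹 → prep _ (prep _ (swap _ _ ↭-refl)) ; ℂ → prep _ (prep _ (swap _ _ ↭-refl)) }
  ; stable   = here (inj₁ refl) ∷ there (there (here (inj₁ refl))) ∷ there (here (inj₁ refl))
             ∷ there (there (there (here (inj₂ refl)))) ∷ []
  }
  where
  adjoint : ∀ p q r s a b c d → p * a + (q * b + (s * c + (r * d + 0ℤ)))
                              ≡ p * a + (q * b + (r * d + (s * c + 0ℤ)))
  adjoint = solve-∀

-- No parameters are admissible

module Refutation (n : ℕ) .{{_ : NonZero n}} where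
  open Residues n
  open Neighbours

  Admissible : Vec ℤ 4 → Set
  Admissible ρ = All (Survive ρ) seeds × Homogeneous ρ

  module _ {σ} (sym-σ : Symmetry σ) where
    open Symmetry sym-σ

    -- By adjointness σ moves from the parameters to the voltages of the darts, which it only
    -- permutes.
    nb-↭ : ∀ ρ u → nb (σ ρ) u ↭ nb ρ u
    nb-↭ ρ u = ↭-trans
      (↭-reflexive (trans
        (map-cong (λ { (t , v) → cong (λ x → at t (rep (index u) + x)) (sym (adjoint v ρ)) }) (darts (part u)))
        (map-∘ (darts (part u)))))
      (map⁺ (along ρ (rep (index u))) (permutes (part u)))

    homogeneous-σ : ∀ ρ → Homogeneous ρ → Homogeneous (σ ρ)
    homogeneous-σ ρ hom k u v x y v∈ y∈ = trans (loops-≡ u v)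
      (trans (hom k u v x y (∈-resp-↭ (nb-↭ ρ u) v∈) (∈-resp-↭ (nb-↭ ρ x) y∈)) (sym (loops-≡ x y)))
      where
      loops-≡ : ∀ u v → loops (nb (σ ρ)) k u v ≡ loops (nb ρ) k u v
      loops-≡ = loops-φ (nb (σ ρ)) (nb ρ) id id (λ u → ↭-trans (↭-reflexive (map-id _)) (nb-↭ ρ u)) k

    survive-σ : ∀ ρ → All (Survive ρ) seeds → All (Survive (σ ρ)) seeds
    survive-σ ρ ss = All.map (λ {φ} φ∼ p → vanishing φ (find φ∼) (∣-≡ (sym (adjoint φ ρ)) p)) stable
      where
      vanishing : ∀ φ → ∃ (λ ψ → ψ ∈ seeds × (σ φ ≡ ψ ⊎ σ φ ≡ ⊝ ψ)) → ¬ N ∣ σ φ · ρ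
      vanishing φ (ψ , ψ∈ , inj₁ eq) p = All.lookup ss ψ∈ (∣-≡ (cong (λ t → t · ρ) eq) p)
      vanishing φ (ψ , ψ∈ , inj₂ eq) p =
        All.lookup ss ψ∈ (χ-∣ (sym (⊝-χ ψ ρ)) (∣-≡ (cong (λ t → t · ρ) eq) p))

    admissible-σ : ∀ ρ → Admissible ρ → Admissible (σ ρ)
    admissible-σ ρ (ss , hom) = survive-σ ρ ss , homogeneous-σ ρ hom

  NeverVanish : List (Form 4) → Set
  NeverVanish Z = ∀ ρ → Admissible ρ → All (Survive ρ) Z

  -- The value of σ φ at ρ is that of φ at σ ρ, which is admissible too; hence the quantification
  -- over all ρ in `NeverVanish`.
  neverVanish-closeUnder : ∀ {σ} → Symmetry σ → ∀ {Z} → NeverVanish Z → NeverVanish (closeUnder σ Z)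
  neverVanish-closeUnder {σ} s nv ρ adm = All.++⁺ (nv ρ adm)
    (All.map⁺ (All.map (λ {φ} ¬p p → ¬p (∣-≡ (Symmetry.adjoint s φ ρ) p)) (nv (σ ρ) (admissible-σ s ρ adm))))

  neverVanish-orbit : ∀ {φ} → NeverVanish (φ ∷ []) → NeverVanish (orbit φ)
  neverVanish-orbit = neverVanish-closeUnder swap₂-symmetry ∘ neverVanish-closeUnder swap₃-symmetry
                    ∘ neverVanish-closeUnder swap₂-symmetry ∘ neverVanish-closeUnder neg₁-symmetry

  refute-sound : ∀ Ps → (∀ ρ → Admissible ρ → All (Balanced ρ) Ps) →
                 ∀ Z → NeverVanish Z → ∀ L c → T (refute Ps Z L c) → ∀ ρ → ¬ Admissible ρ
  refute-sound Ps bal Z nv []             c ok ρ adm =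
    check-sound ρ Ps (bal ρ adm) empty (valid-empty ρ) Z (nv ρ adm) c ok
  refute-sound Ps bal Z nv ((φ , c′) ∷ L) c ok with T-× {check Ps (insert φ empty) Z c′} ok
  ... | ok₁ , ok₂ = refute-sound Ps bal (orbit φ ++ Z)
    (λ ρ adm → All.++⁺ (neverVanish-orbit survives ρ adm) (nv ρ adm)) L c ok₂
    where
    survives : NeverVanish (φ ∷ [])
    survives ρ adm = (λ p → check-sound ρ Ps (bal ρ adm) (insert φ empty)
      (insert-valid φ empty ρ p (valid-empty ρ)) Z (nv ρ adm) c′ ok₁) ∷ []

  refuted : ∀ Ps → (∀ ρ → Admissible ρ → All (Balanced ρ) Ps) →
            ∀ L c → refute Ps seeds L c ≡ true → ∀ ρ → ¬ Admissible ρ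
  refuted Ps bal L c eq = refute-sound Ps bal seeds (λ ρ adm → proj₁ adm) L c (Equivalence.from T-≡ eq)

  inadmissible : ∀ ρ → ¬ Admissible ρ
  inadmissible = refuted (profiles 8 0 level₀ level₁)
    (λ ρ adm → profiles-balanced ρ (proj₂ adm) 8 0 level₀ level₁ (counts-level₀ ρ) (counts-level₁ ρ))
    layers last certified

-- Woolly Hat graphs

module WoollyHat {m : ℕ} (a b c d : Fin (suc m)) where
  open Residues (suc m)

  ρ : Vec ℤ 4
  ρ = rep a ∷ rep b ∷ rep c ∷ rep d ∷ []

  open Neighbours ρ

  ·-a⁺ : a⁺ · ρ ≡ rep a
  ·-a⁺ = lemma (rep a) (rep b) (rep c) (rep d)
    where
    lemma : ∀ a b c d → 1ℤ * a + (0ℤ * b + (0ℤ * c + (0ℤ * d + 0ℤ))) ≡ a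
    lemma = solve-∀

  ·-b⁺ : b⁺ · ρ ≡ rep b
  ·-b⁺ = lemma (rep a) (rep b) (rep c) (rep d)
    where
    lemma : ∀ a b c d → 0ℤ * a + (1ℤ * b + (0ℤ * c + (0ℤ * d + 0ℤ))) ≡ b
    lemma = solve-∀

  ·-c⁺ : c⁺ · ρ ≡ rep c
  ·-c⁺ = lemma (rep a) (rep b) (rep c) (rep d)
    where
    lemma : ∀ a b c d → 0ℤ * a + (0ℤ * b + (1ℤ * c + (0ℤ * d + 0ℤ))) ≡ c
    lemma = solve-∀

  ·-d⁺ : d⁺ · ρ ≡ rep d
  ·-d⁺ = lemma (rep a) (rep b) (rep c) (rep d)
    where
    lemma : ∀ a b c d → 0ℤ * a + (0ℤ * b + (0ℤ * c + (1ℤ * d + 0ℤ))) ≡ d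
    lemma = solve-∀

  stay : ∀ i → ι (rep i + 𝟎 · ρ) ≡ i
  stay i = trans (cong ι (trans (+-congˡ (rep i) (·-𝟎 ρ)) (+-identityʳ (rep i)))) (ι-pos i)

  forward : ∀ i {v x} → v · ρ ≡ rep x → ι (rep i + v · ρ) ≡ i ⊕ x
  forward i eq = cong (λ t → ι (rep i + t)) eq

  ⊕-≈ : ∀ i x → rep (i ⊕ x) ≈ rep i + rep x
  ⊕-≈ i x = ≈-sym (rep-ι (rep i + rep x))

  backward : ∀ i {v x} → v · ρ ≡ rep x → ι (rep (i ⊕ x) + (⊝ v) · ρ) ≡ i
  backward i {v} {x} eq = trans
    (ι-cong (≈-trans (+-≈ ((⊝ v) · ρ) (⊕-≈ i x)) (≈-reflexive
      (trans (+-congˡ (rep i + rep x) (trans (·-neg v ρ) (cong -_ eq))) (lemma (rep i) (rep x))))))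
    (ι-pos i)
    where
    lemma : ∀ i x → (i + x) + - x ≡ i
    lemma = solve-∀

  back : Fin (suc m) → Form 4 → Fin (suc m)
  back i v = ι (rep i + (⊝ v) · ρ)

  unbackward : ∀ i {v x} → v · ρ ≡ rep x → back i v ⊕ x ≡ i
  unbackward i {v} {x} eq = trans
    (ι-cong {rep (back i v) + rep x} {rep i} (≈-trans (+-≈ (rep x) (≈-sym (rep-ι (rep i + (⊝ v) · ρ)))) (≈-reflexive
      (trans (cong (λ t → (rep i + t) + rep x) (trans (·-neg v ρ) (cong -_ eq))) (lemma (rep i) (rep x))))))
    (ι-pos i)
    where
    lemma : ∀ i x → (i + - x) + x ≡ i
    lemma = solve-∀

  Adj : Vtx (suc m) → Vtx (suc m) → Set
  Adj = WHAdj a b c d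

  adj⇒∈ : ∀ {u v} → Adj u v → v ∈ nb u
  adj⇒∈ (inj₁ (AA i))  = here (cong A (sym (forward i {a⁺} ·-a⁺)))
  adj⇒∈ (inj₁ (AB i))  = there (there (here (cong B (sym (stay i)))))
  adj⇒∈ (inj₁ (AC i))  = there (there (there (here (cong C (sym (stay i))))))
  adj⇒∈ (inj₁ (BCb i)) = there (here (cong C (sym (forward i {b⁺} ·-b⁺))))
  adj⇒∈ (inj₁ (BCc i)) = there (there (here (cong C (sym (forward i {c⁺} ·-c⁺)))))
  adj⇒∈ (inj₁ (BCd i)) = there (there (there (here (cong C (sym (forward i {d⁺} ·-d⁺))))))
  adj⇒∈ (inj₂ (AA i))  = there (here (cong A (sym (backward i {a⁺} ·-a⁺))))
  adj⇒∈ (inj₂ (AB i))  = here (cong A (sym (stay i)))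
  adj⇒∈ (inj₂ (AC i))  = here (cong A (sym (stay i)))
  adj⇒∈ (inj₂ (BCb i)) = there (here (cong B (sym (backward i {b⁺} ·-b⁺))))
  adj⇒∈ (inj₂ (BCc i)) = there (there (here (cong B (sym (backward i {c⁺} ·-c⁺)))))
  adj⇒∈ (inj₂ (BCd i)) = there (there (there (here (cong B (sym (backward i {d⁺} ·-d⁺))))))

  G : Vtx (suc m) → Vtx (suc m) → Set
  G = Gen a b c d

  ∈⇒adj : ∀ u {v} → v ∈ nb u → Adj u v
  ∈⇒adj (A i) (here refl) = inj₁ (subst (G (A i) ∘ A) (sym (forward i {a⁺} ·-a⁺)) (AA i))
  ∈⇒adj (A i) (there (here refl)) = inj₂ (subst (G (A (back i a⁺)) ∘ A) (unbackward i {a⁺} ·-a⁺) (AA (back i a⁺)))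
  ∈⇒adj (A i) (there (there (here refl))) = inj₁ (subst (G (A i) ∘ B) (sym (stay i)) (AB i))
  ∈⇒adj (A i) (there (there (there (here refl)))) = inj₁ (subst (G (A i) ∘ C) (sym (stay i)) (AC i))
  ∈⇒adj (B i) (here refl) = inj₂ (subst (λ j → G (A j) (B i)) (sym (stay i)) (AB i))
  ∈⇒adj (B i) (there (here refl)) = inj₁ (subst (G (B i) ∘ C) (sym (forward i {b⁺} ·-b⁺)) (BCb i))
  ∈⇒adj (B i) (there (there (here refl))) = inj₁ (subst (G (B i) ∘ C) (sym (forward i {c⁺} ·-c⁺)) (BCc i))
  ∈⇒adj (B i) (there (there (there (here refl)))) = inj₁ (subst (G (B i) ∘ C) (sym (forward i {d⁺} ·-d⁺)) (BCd i))
  ∈⇒adj (C i) (here refl) = inj₂ (subst (λ j → G (A j) (C i)) (sym (stay i)) (AC i))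
  ∈⇒adj (C i) (there (here refl)) = inj₂ (subst (G (B (back i b⁺)) ∘ C) (unbackward i {b⁺} ·-b⁺) (BCb (back i b⁺)))
  ∈⇒adj (C i) (there (there (here refl))) = inj₂ (subst (G (B (back i c⁺)) ∘ C) (unbackward i {c⁺} ·-c⁺) (BCc (back i c⁺)))
  ∈⇒adj (C i) (there (there (there (here refl)))) = inj₂ (subst (G (B (back i d⁺)) ∘ C) (unbackward i {d⁺} ·-d⁺) (BCd (back i d⁺)))

  seeds-survive : toℕ (a ⊕ a) ≢ 0 → b ≢ c → b ≢ d → c ≢ d → All (Survive ρ) seeds
  seeds-survive 2a≢0 b≢c b≢d c≢d =
    (λ p → 2a≢0 (trans (cong toℕ (ι-cong {rep a + rep a} {0ℤ}
      (congruent (∣-≡ (trans (·-+ a⁺ a⁺ ρ) (trans (cong₂ _+_ ·-a⁺ ·-a⁺) (sym (+-identityʳ (rep a + rep a))))) p))))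
      (toℕ-fromℕ< (n%ℕd<d 0ℤ (suc m)))))
    ∷ apart {v = b⁺} {c⁺} ·-b⁺ ·-c⁺ b≢c ∷ apart {v = b⁺} {d⁺} ·-b⁺ ·-d⁺ b≢d
    ∷ apart {v = c⁺} {d⁺} ·-c⁺ ·-d⁺ c≢d ∷ []
    where
    apart : ∀ {v w x y} → v · ρ ≡ rep x → w · ρ ≡ rep y → x ≢ y → Survive ρ (v ⊕ᶠ ⊝ w)
    apart {v} {w} eq eq′ x≢y p = x≢y (rep-injective (congruent
      (∣-≡ (trans (·-+ v (⊝ w) ρ) (cong₂ _+_ eq (trans (·-neg w ρ) (cong -_ eq′)))) p)))

  -- An automorphism preserves neighbour sets; absence of repetitions turns this into a permutation
  -- of neighbour lists, as the sums over them require.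
  nb-unique : All (Survive ρ) seeds → ∀ u → Unique (nb u)
  nb-unique (2a ∷ bc ∷ bd ∷ cd ∷ []) = λ
    { (A i) → (≢ 𝔸 i a⁺ (⊝ a⁺) 2a ∷ (λ ()) ∷ (λ ()) ∷ []) ∷ ((λ ()) ∷ (λ ()) ∷ []) ∷ ((λ ()) ∷ []) ∷ [] ∷ []
    ; (B i) → ((λ ()) ∷ (λ ()) ∷ (λ ()) ∷ []) ∷ (≢ ℂ i b⁺ c⁺ bc ∷ ≢ ℂ i b⁺ d⁺ bd ∷ [])
            ∷ (≢ ℂ i c⁺ d⁺ cd ∷ []) ∷ [] ∷ []
    -- -c - (-b) evaluates to the seed b - c, hence the reversed order and `≢-sym`.
    ; (C i) → ((λ ()) ∷ (λ ()) ∷ (λ ()) ∷ []) ∷ (≢-sym (≢ 𝔹 i (⊝ c⁺) (⊝ b⁺) bc) ∷ ≢-sym (≢ 𝔹 i (⊝ d⁺) (⊝ b⁺) bd) ∷ [])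
            ∷ (≢-sym (≢ 𝔹 i (⊝ d⁺) (⊝ c⁺) cd) ∷ []) ∷ [] ∷ []
    }
    where
    ≢ : ∀ t i v w → Survive ρ (v ⊕ᶠ ⊝ w) → along (rep i) (t , v) ≢ along (rep i) (t , w)
    ≢ t i v w ¬p eq with ι-injective {rep i + v · ρ} {rep i + w · ρ}
                           (trans (sym (index-vertex t _)) (trans (cong index eq) (index-vertex t _)))
    ... | congruent p = ¬p (∣-≡ (trans (lemma (rep i) (v · ρ) (w · ρ))
                                  (sym (trans (·-+ v (⊝ w) ρ) (+-congˡ (v · ρ) (·-neg w ρ))))) p)
      where
      lemma : ∀ i v w → (i + v) - (i + w) ≡ v + - w
      lemma = solve-∀

  module _ (unique : ∀ u → Unique (nb u)) (σ : Automorphism Adj) where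
    open Automorphism σ

    f : Vtx (suc m) → Vtx (suc m)
    f = Inverse.to perm

    f-injective : Injective _≡_ _≡_ f
    f-injective {x} {y} eq = trans (sym (Inverse.strictlyInverseʳ perm x))
                               (trans (cong (Inverse.from perm) eq) (Inverse.strictlyInverseʳ perm y))

    f-nb : ∀ u → map f (nb u) ↭ nb (f u)
    f-nb u = ∼bag⇒↭ (unique∧set⇒bag (Unique.map⁺ f-injective (unique u)) (unique (f u)) (mk⇔ to from))
      where
      to : ∀ {x} → x ∈ map f (nb u) → x ∈ nb (f u)
      to x∈ with ∈-map⁻ f x∈
      ... | w , w∈ , refl = adj⇒∈ (Equivalence.to (preserve u w) (∈⇒adj u w∈))
      from : ∀ {x} → x ∈ nb (f u) → x ∈ map f (nb u)
      from {x} x∈ = subst (_∈ map f (nb u)) (Inverse.strictlyInverseˡ perm x) (∈-map⁺ f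
        (adj⇒∈ (Equivalence.from (preserve u w)
          (∈⇒adj (f u) (subst (_∈ nb (f u)) (sym (Inverse.strictlyInverseˡ perm x)) x∈)))))
        where
        w = Inverse.from perm x

    loops-invariant : ∀ k u v → loops nb k u v ≡ loops nb k (f u) (f v)
    loops-invariant = loops-φ nb nb f f-injective f-nb

  homogeneous : (∀ u → Unique (nb u)) → EdgeTransitive Adj → Homogeneous
  homogeneous unique et k u v x y v∈ y∈ with et u v x y (∈⇒adj u v∈) (∈⇒adj x y∈)
  ... | σ , inj₁ (refl , refl) = loops-invariant unique σ k u v
  ... | σ , inj₂ (refl , refl) = trans (loops-invariant unique σ k u v) (+-comm (walks nb k y x) (walks nb k x y))

theorem3p7 : (n : ℕ) (a b c d : Fin n) → WHDefined n a b c d →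
    ¬ EdgeTransitive (WHAdj a b c d)
theorem3p7 (suc m) a b c d (_ , 2a≢0 , b≢c , b≢d , c≢d , _) et =
  Refutation.inadmissible (suc m) ρ (survive , homogeneous (nb-unique survive) et)
  where
  open WoollyHat a b c d
  survive : All (Residues.Survive (suc m) ρ) seeds
  survive = seeds-survive 2a≢0 b≢c b≢d c≢d
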